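{- Let $P$ be a quasi-graded poset with $\hat0$ and $\hat1$, $\hat0<\hat1$. Then the $\mathbf{ab}$-index of the Cartesian product of $P$ with the Boolean algebra $B_1$ satisfies $$\Psi(P\times B_1)=\mathbf b\cdot\Psi(P)+\Psi(P)\cdot\mathbf a+\sum_{x\in P,\ \hat0<x<\hat1}\Psi([\hat0,x])\cdot\mathbf a\mathbf b\cdot\Psi([x,\hat1]),$$ and $$\Psi(P\times B_1)=\mathrm{Pyr}(\Psi(P)).$$
   Context: A quasi-graded poset $(P,\rho,\bar\zeta)$ consists of a finite poset $P$, a function $\rho:P\to\mathbb N$ with $x<y\Rightarrow\rho(x)<\rho(y)$, and a complex-valued function $\bar\zeta$ in the incidence algebra of $P$ with $\bar\zeta(x,x)=1$ for all $x$. Write $\rho(x,y)=\rho(y)-\rho(x)$. Intervals $[x,y]$ are quasi-graded posets by restricting $\rho$ (shifted by $\rho(x)$) and $\bar\zeta$. If $P$ has minimal element $\hat0$ and maximal element $\hat1$ with $\hat0<\hat1$, its $\mathbf{ab}$-index is the polynomial in non-commuting variables $\mathbf a,\mathbf b$ $$\Psi(P)=\sum_{c}\bar\zeta(x_0,x_1)\cdots\bar\zeta(x_{k-1},x_k)\cdot(\mathbf a-\mathbf b)^{\rho(x_0,x_1)-1}\,\mathbf b\,(\mathbf a-\mathbf b)^{\rho(x_1,x_2)-1}\,\mathbf b\cdots\mathbf b\,(\mathbf a-\mathbf b)^{\rho(x_{k-1},x_k)-1},$$ the sum over all chains $c=\{\hat0=x_0<x_1<\cdots<x_k=\hat1\}$,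 $k\ge1$. The Cartesian product of quasi-graded posets $(P,\rho_P,\bar\zeta_P)$ and $(Q,\rho_Q,\bar\zeta_Q)$ is $P\times Q$ with the componentwise order, $\rho((x,y))=\rho_P(x)+\rho_Q(y)$ and $\bar\zeta((x,y),(z,w))=\bar\zeta_P(x,z)\cdot\bar\zeta_Q(y,w)$. $B_1=\{\hat0<\hat1\}$ has $\rho(\hat0)=0$, $\rho(\hat1)=1$, $\bar\zeta(\hat0,\hat1)=1$. $G$ is the linear derivation on non-commutative polynomials in $\mathbf a,\mathbf b$ determined by $G(\mathbf a)=\mathbf b\mathbf a$, $G(\mathbf b)=\mathbf a\mathbf b$ (so $G(uv)=G(u)v+uG(v)$), and $\mathrm{Pyr}(w)=w\cdot\mathbf c+G(w)$ with $\mathbf c=\mathbf a+\mathbf b$. -}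

module Defs where

open import Level using (Level; 0ℓ; _⊔_) renaming (suc to lsuc)
open import Algebra.Bundles using (CommutativeRing)
open import Data.Bool.Base as Bool using (Bool; true; false; b≤b; f≤t; if_then_else_)
import Data.Bool.Properties as Bool
open import Data.List.Base using (List; []; _∷_; [_]; _++_; map; concatMap; cartesianProduct; cartesianProductWith; filter; foldr; upTo)
open import Data.List.Membership.Setoid using (_∈_)
open import Data.List.Properties using (≡-dec)
open import Data.List.Relation.Unary.All as All using (All; []; _∷_)
open import Data.List.Relation.Unary.AllPairs using ([]; _∷_)
open import Data.List.Relation.Unary.Any using (here; there)
open import Data.List.Relation.Unary.Enumerates.Setoid using (IsEnumeration)
import Data.List.Relation.Unary.Enumerates.Setoid.Properties as Enumerates
open import Data.List.Relation.Unary.Linked using (Linked; linked?)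
open import Data.List.Relation.Unary.Unique.Setoid using (Unique)
import Data.List.Relation.Unary.Unique.Setoid.Properties as Unique
open import Data.Nat.Base as ℕ using (ℕ; zero; suc; _∸_; z≤n; s≤s)
import Data.Nat.Properties as ℕ
open import Data.Product.Base using (_×_; _,_; ∃; proj₁; proj₂; map₁)
open import Data.Product.Relation.Binary.Pointwise.NonDependent using (×-isPartialOrder; ×-decidable)
open import Function.Base using (_∘_)
open import Relation.Binary.Bundles using (Setoid; DecPoset)
open import Relation.Binary.Definitions using (Minimum; Maximum; DecidableEquality)
import Relation.Binary.Construct.NonStrictToStrict as Strict
import Relation.Binary.Construct.On as On
open import Relation.Binary.PropositionalEquality using (_≡_; refl; cong; cong₂)
open import Relation.Nullary using (¬_; Dec; yes; no; contradiction)
open import Relation.Nullary.Decidable using (_×-dec_; does)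
open import Relation.Unary using (Pred; Decidable)

private
  variable
    e p c ℓ₁ ℓ₂ d ℓ₃ ℓ₄ : Level

subtypeList : {A : Set e} {P : Pred A p} → Decidable P → List A → List (∃ P)
subtypeList P? []       = []
subtypeList P? (x ∷ xs) with P? x
... | yes px = (x , px) ∷ subtypeList P? xs
... | no  _  = subtypeList P? xs

module _ (S : Setoid e ℓ₁) {P : Pred (Setoid.Carrier S) p} (P? : Decidable P) where
  open Setoid S using (_≈_; _≉_)

  private
    subS : Setoid _ _
    subS = On.setoid S (proj₁ {B = P})

  subtypeList-enumerates : (∀ {x y} → x ≈ y → P x → P y) →
    ∀ {xs} → IsEnumeration S xs → IsEnumeration subS (subtypeList P? xs)
  subtypeList-enumerates resp enum (y , py) = go (enum y)
    where
    go : ∀ {xs} → _∈_ S y xs → _∈_ subS (y , py) (subtypeList P? xs)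
    go {x ∷ xs} y∈ with P? x | y∈
    ... | yes _ | here y≈x  = here y≈x
    ... | yes _ | there y∈′ = there (go y∈′)
    ... | no ¬p | here y≈x  = contradiction (resp y≈x py) ¬p
    ... | no _  | there y∈′ = go y∈′

  subtypeList-unique : ∀ {xs} → Unique S xs → Unique subS (subtypeList P? xs)
  subtypeList-unique []                     = []
  subtypeList-unique {x ∷ xs} (x≉xs ∷ uniq) with P? x
  ... | yes _ = all≉ x≉xs ∷ subtypeList-unique uniq
    where
    all≉ : ∀ {ys} → All (x ≉_) ys → All ((x ≉_) ∘ proj₁) (subtypeList P? ys)
    all≉ []                 = []
    all≉ {y ∷ ys} (x≉y ∷ r) with P? y
    ... | yes _ = x≉y ∷ all≉ r
    ... | no  _ = all≉ r
  ... | no  _ = subtypeList-unique uniq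

record FinitePoset c ℓ₁ ℓ₂ : Set (lsuc (c ⊔ ℓ₁ ⊔ ℓ₂)) where
  field
    decPoset : DecPoset c ℓ₁ ℓ₂

  open DecPoset decPoset public
  open Strict _≈_ _≤_ public using (_<_; <-decidable)

  setoid : Setoid c ℓ₁
  setoid = Eq.setoid

  field
    elements   : List Carrier
    enumerates : IsEnumeration setoid elements
    unique     : Unique setoid elements

  _<?_ : ∀ x y → Dec (x < y)
  _<?_ = <-decidable _≟_ _≤?_

_×ᶠ_ : FinitePoset c ℓ₁ ℓ₂ → FinitePoset d ℓ₃ ℓ₄ → FinitePoset (c ⊔ d) (ℓ₁ ⊔ ℓ₃) (ℓ₂ ⊔ ℓ₄)
P ×ᶠ Q = record
  { decPoset   = record
    { isDecPartialOrder = record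
      { isPartialOrder = ×-isPartialOrder P.isPartialOrder Q.isPartialOrder
      ; _≟_            = ×-decidable P._≟_ Q._≟_
      ; _≤?_           = ×-decidable P._≤?_ Q._≤?_
      }
    }
  ; elements   = cartesianProduct P.elements Q.elements
  ; enumerates = Enumerates.cartesianProduct⁺ P.setoid Q.setoid P.enumerates Q.enumerates
  ; unique     = Unique.cartesianProduct⁺ P.setoid Q.setoid P.unique Q.unique
  }
  where
  module P = FinitePoset P
  module Q = FinitePoset Q

intervalᶠ : (P : FinitePoset c ℓ₁ ℓ₂) (x y : FinitePoset.Carrier P) → FinitePoset (c ⊔ ℓ₂) ℓ₁ ℓ₂
intervalᶠ P x y = record
  { decPoset   = On.decPoset P.decPoset (proj₁ {B = λ z → x P.≤ z × z P.≤ y})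
  ; elements   = subtypeList in? P.elements
  ; enumerates = subtypeList-enumerates P.setoid in? in-resp P.enumerates
  ; unique     = subtypeList-unique P.setoid in? P.unique
  }
  where
  module P = FinitePoset P
  in? : ∀ z → Dec (x P.≤ z × z P.≤ y)
  in? z = (x P.≤? z) ×-dec (z P.≤? y)
  in-resp : ∀ {z w} → z P.≈ w → x P.≤ z × z P.≤ y → x P.≤ w × w P.≤ y
  in-resp z≈w (x≤z , z≤y) =
    P.trans x≤z (P.reflexive z≈w) , P.trans (P.reflexive (P.Eq.sym z≈w)) z≤y

Bool-finitePoset : FinitePoset 0ℓ 0ℓ 0ℓ
Bool-finitePoset = record
  { decPoset   = record
    { isDecPartialOrder = record
      { isPartialOrder = Bool.≤-isPartialOrder
      ; _≟_            = Bool._≟_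
      ; _≤?_           = Bool._≤?_
      }
    }
  ; elements   = false ∷ true ∷ []
  ; enumerates = λ { false → here refl ; true → there (here refl) }
  ; unique     = ((λ ()) ∷ []) ∷ [] ∷ []
  }

data Letter : Set where
  𝐚 𝐛 : Letter

_≟ᴸ_ : DecidableEquality Letter
𝐚 ≟ᴸ 𝐚 = yes refl
𝐚 ≟ᴸ 𝐛 = no λ ()
𝐛 ≟ᴸ 𝐚 = no λ ()
𝐛 ≟ᴸ 𝐛 = yes refl

Word : Set
Word = List Letter

_≟ᵂ_ : DecidableEquality Word
_≟ᵂ_ = ≡-dec _≟ᴸ_

-- Everything below is relative to a commutative ring R of scalars, which
-- takes the place of ℂ: no property of ℂ beyond the commutative ring
-- axioms enters the definitions.
module Over {r ℓ} (R : CommutativeRing r ℓ) where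

  private
    module R = CommutativeRing R

  -- Non-commutative polynomials R⟨𝐚,𝐛⟩, as formal sums of monomials.
  -- Repeated words and zero coefficients are allowed in the list;
  -- equality of polynomials is equality of all collected coefficients.
  Poly : Set r
  Poly = List (R.Carrier × Word)

  coeff : Poly → Word → R.Carrier
  coeff []            w = R.0#
  coeff ((s , u) ∷ f) w = (if does (u ≟ᵂ w) then s else R.0#) R.+ coeff f w

  infix 4 _≈ₚ_
  record _≈ₚ_ (f g : Poly) : Set ℓ where
    constructor mk≈ₚ
    field
      coeff-≈ : ∀ w → coeff f w R.≈ coeff g w

  infixl 6 _+ₚ_ _-ₚ_
  infixl 7 _*ₚ_
  infixr 8 _^ₚ_
  infixr 7 _·ₚ_

  0ₚ 1ₚ a b 𝐜 : Poly

  _+ₚ_ _-ₚ_ _*ₚ_ : Poly → Poly → Poly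
  _·ₚ_ : R.Carrier → Poly → Poly
  _^ₚ_ : Poly → ℕ → Poly

  0ₚ = []
  1ₚ = [ (R.1# , []) ]

  f +ₚ g = f ++ g
  s ·ₚ f = map (map₁ (s R.*_)) f
  f -ₚ g = f +ₚ (R.- R.1#) ·ₚ g
  _*ₚ_   = cartesianProductWith (λ (s , u) (t , v) → s R.* t , u ++ v)

  f ^ₚ zero  = 1ₚ
  f ^ₚ suc n = f *ₚ f ^ₚ n

  sumₚ : {I : Set c} → List I → (I → Poly) → Poly
  sumₚ is f = foldr (λ i g → f i +ₚ g) 0ₚ is

  word : Word → Poly
  word u = [ (R.1# , u) ]

  a = word [ 𝐚 ]
  b = word [ 𝐛 ]
  𝐜 = a +ₚ b

  G-letter : Letter → Poly
  G-letter 𝐚 = b *ₚ a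
  G-letter 𝐛 = a *ₚ b

  -- The Leibniz rule, applied letter by letter; in particular G(1) = 0.
  G-word : Word → Poly
  G-word []      = 0ₚ
  G-word (x ∷ u) = G-letter x *ₚ word u +ₚ word [ x ] *ₚ G-word u

  G : Poly → Poly
  G f = sumₚ f λ (s , u) → s ·ₚ G-word u

  Pyr : Poly → Poly
  Pyr f = f *ₚ 𝐜 +ₚ G f

  -- ζ̄ is an element of the incidence algebra, given as a function on all
  -- pairs that vanishes off the order relation.
  record QuasiGradedPoset c ℓ₁ ℓ₂ : Set (r ⊔ ℓ ⊔ lsuc (c ⊔ ℓ₁ ⊔ ℓ₂)) where
    field
      finitePoset : FinitePoset c ℓ₁ ℓ₂

    open FinitePoset finitePoset public

    field
      ρ         : Carrier → ℕ
      ρ-cong    : ∀ {x y} → x ≈ y → ρ x ≡ ρ y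
      ρ-mono-<  : ∀ {x y} → x < y → ρ x ℕ.< ρ y
      ζ̄         : Carrier → Carrier → R.Carrier
      ζ̄-cong    : ∀ {x x′ y y′} → x ≈ x′ → y ≈ y′ → ζ̄ x y R.≈ ζ̄ x′ y′
      ζ̄-support : ∀ {x y} → ¬ x ≤ y → ζ̄ x y R.≈ R.0#
      ζ̄-diag    : ∀ x → ζ̄ x x R.≈ R.1#

    ρ[_,_] : Carrier → Carrier → ℕ
    ρ[ x , y ] = ρ y ∸ ρ x

    ρ-mono-≤ : ∀ {x y} → x ≤ y → ρ x ℕ.≤ ρ y
    ρ-mono-≤ {x} {y} x≤y with x ≟ y
    ... | yes x≈y = ℕ.≤-reflexive (ρ-cong x≈y)
    ... | no  x≉y = ℕ.<⇒≤ (ρ-mono-< (x≤y , x≉y))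

  record BoundedQuasiGradedPoset c ℓ₁ ℓ₂ : Set (r ⊔ ℓ ⊔ lsuc (c ⊔ ℓ₁ ⊔ ℓ₂)) where
    field
      quasiGradedPoset : QuasiGradedPoset c ℓ₁ ℓ₂

    open QuasiGradedPoset quasiGradedPoset public

    field
      0̂ 1̂     : Carrier
      minimum : Minimum _≤_ 0̂
      maximum : Maximum _≤_ 1̂
      0̂<1̂     : 0̂ < 1̂

  interval : (P : QuasiGradedPoset c ℓ₁ ℓ₂) (x y : QuasiGradedPoset.Carrier P) →
             QuasiGradedPoset (c ⊔ ℓ₂) ℓ₁ ℓ₂
  interval P x y = record
    { finitePoset = intervalᶠ P.finitePoset x y
    ; ρ           = λ (z , _) → P.ρ[ x , z ]
    ; ρ-cong      = λ z≈w → cong (_∸ P.ρ x) (P.ρ-cong z≈w)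
    ; ρ-mono-<    = λ {(_ , x≤z , _)} z<w → ℕ.∸-monoˡ-< (P.ρ-mono-< z<w) (P.ρ-mono-≤ x≤z)
    ; ζ̄           = λ (z , _) (w , _) → P.ζ̄ z w
    ; ζ̄-cong      = P.ζ̄-cong
    ; ζ̄-support   = P.ζ̄-support
    ; ζ̄-diag      = λ (z , _) → P.ζ̄-diag z
    }
    where module P = QuasiGradedPoset P

  boundedInterval : (P : QuasiGradedPoset c ℓ₁ ℓ₂) → let open QuasiGradedPoset P in
                    (x y : Carrier) → x < y → BoundedQuasiGradedPoset (c ⊔ ℓ₂) ℓ₁ ℓ₂
  boundedInterval P x y x<y@(x≤y , _) = record
    { quasiGradedPoset = interval P x y
    ; 0̂                = x , refl≤ , x≤y
    ; 1̂                = y , x≤y , refl≤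
    ; minimum          = λ (_ , x≤z , _) → x≤z
    ; maximum          = λ (_ , _ , z≤y) → z≤y
    ; 0̂<1̂              = x<y
    }
    where open QuasiGradedPoset P using () renaming (refl to refl≤)

  product : QuasiGradedPoset c ℓ₁ ℓ₂ → QuasiGradedPoset d ℓ₃ ℓ₄ →
            QuasiGradedPoset (c ⊔ d) (ℓ₁ ⊔ ℓ₃) (ℓ₂ ⊔ ℓ₄)
  product P Q = record
    { finitePoset = P.finitePoset ×ᶠ Q.finitePoset
    ; ρ           = λ (x , y) → P.ρ x ℕ.+ Q.ρ y
    ; ρ-cong      = λ (x≈z , y≈w) → cong₂ ℕ._+_ (P.ρ-cong x≈z) (Q.ρ-cong y≈w)
    ; ρ-mono-<    = mono
    ; ζ̄           = λ (x , y) (z , w) → P.ζ̄ x z R.* Q.ζ̄ y w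
    ; ζ̄-cong      = λ (x≈ , y≈) (z≈ , w≈) → R.*-cong (P.ζ̄-cong x≈ z≈) (Q.ζ̄-cong y≈ w≈)
    ; ζ̄-support   = support
    ; ζ̄-diag      = λ (x , y) → R.trans (R.*-cong (P.ζ̄-diag x) (Q.ζ̄-diag y)) (R.*-identityˡ R.1#)
    }
    where
    module P = QuasiGradedPoset P
    module Q = QuasiGradedPoset Q
    module P×Q = FinitePoset (P.finitePoset ×ᶠ Q.finitePoset)

    mono : ∀ {s t} → s P×Q.< t → P.ρ (proj₁ s) ℕ.+ Q.ρ (proj₂ s) ℕ.< P.ρ (proj₁ t) ℕ.+ Q.ρ (proj₂ t)
    mono {x , y} {z , w} ((x≤z , y≤w) , ≉) with x P.≟ z
    ... | no  x≉z = ℕ.+-mono-<-≤ (P.ρ-mono-< (x≤z , x≉z)) (Q.ρ-mono-≤ y≤w)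
    ... | yes x≈z = ℕ.+-mono-≤-< (P.ρ-mono-≤ x≤z) (Q.ρ-mono-< (y≤w , λ y≈w → ≉ (x≈z , y≈w)))

    support : ∀ {s t} → ¬ s P×Q.≤ t → P.ζ̄ (proj₁ s) (proj₁ t) R.* Q.ζ̄ (proj₂ s) (proj₂ t) R.≈ R.0#
    support {x , y} {z , w} ≰ with x P.≤? z
    ... | no  x≰z = R.trans (R.*-congʳ (P.ζ̄-support x≰z)) (R.zeroˡ _)
    ... | yes x≤z = R.trans (R.*-congˡ (Q.ζ̄-support λ y≤w → ≰ (x≤z , y≤w))) (R.zeroʳ _)

  infixr 2 _⊗_
  _⊗_ : BoundedQuasiGradedPoset c ℓ₁ ℓ₂ → BoundedQuasiGradedPoset d ℓ₃ ℓ₄ →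
        BoundedQuasiGradedPoset (c ⊔ d) (ℓ₁ ⊔ ℓ₃) (ℓ₂ ⊔ ℓ₄)
  P ⊗ Q = record
    { quasiGradedPoset = product P.quasiGradedPoset Q.quasiGradedPoset
    ; 0̂                = P.0̂ , Q.0̂
    ; 1̂                = P.1̂ , Q.1̂
    ; minimum          = λ (x , y) → P.minimum x , Q.minimum y
    ; maximum          = λ (x , y) → P.maximum x , Q.maximum y
    ; 0̂<1̂              = (proj₁ P.0̂<1̂ , proj₁ Q.0̂<1̂) , λ (0≈1 , _) → proj₂ P.0̂<1̂ 0≈1
    }
    where
    module P = BoundedQuasiGradedPoset P
    module Q = BoundedQuasiGradedPoset Q

  B₁ : BoundedQuasiGradedPoset 0ℓ 0ℓ 0ℓ
  B₁ = record
    { quasiGradedPoset = record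
      { finitePoset = Bool-finitePoset
      ; ρ           = λ { false → 0 ; true → 1 }
      ; ρ-cong      = λ { refl → refl }
      ; ρ-mono-<    = λ { (b≤b , x≉x) → contradiction refl x≉x ; (f≤t , _) → s≤s z≤n }
      ; ζ̄           = ζ
      ; ζ̄-cong      = λ { refl refl → R.refl }
      ; ζ̄-support   = support
      ; ζ̄-diag      = λ { false → R.refl ; true → R.refl }
      }
    ; 0̂                = false
    ; 1̂                = true
    ; minimum          = Bool.≤-minimum
    ; maximum          = Bool.≤-maximum
    ; 0̂<1̂              = f≤t , λ ()
    }
    where
    ζ : Bool → Bool → R.Carrier
    ζ true  false = R.0#
    ζ true  true  = R.1#
    ζ false _     = R.1#

    support : ∀ {x y} → ¬ x Bool.≤ y → ζ x y R.≈ R.0#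
    support {false} {y}     ≰ = contradiction (Bool.≤-minimum y) ≰
    support {true}  {false} _ = R.refl
    support {true}  {true}  ≰ = contradiction b≤b ≰

  module _ (P : BoundedQuasiGradedPoset c ℓ₁ ℓ₂) where
    open BoundedQuasiGradedPoset P

    tuples : ℕ → List (List Carrier)
    tuples zero    = [ [] ]
    tuples (suc n) = cartesianProductWith _∷_ elements (tuples n)

    -- A chain 0̂ = x₀ < x₁ < ⋯ < x_k = 1̂ is recorded by x₁, …, x_{k-1}.
    IsChain : List Carrier → Set _
    IsChain xs = Linked _<_ (0̂ ∷ xs ++ [ 1̂ ])

    -- k-1 < ρ(0̂,1̂) for every such chain, since ρ is strictly increasing;
    -- hence the bound on the length loses no chain.
    chains : List (List Carrier)
    chains = filter (λ xs → linked? _<?_ (0̂ ∷ xs ++ [ 1̂ ])) (concatMap tuples (upTo ρ[ 0̂ , 1̂ ]))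

    ζ̄-along : Carrier → List Carrier → R.Carrier
    ζ̄-along x []       = ζ̄ x 1̂
    ζ̄-along x (y ∷ ys) = ζ̄ x y R.* ζ̄-along y ys

    weight : Carrier → List Carrier → Poly
    weight x []       = (a -ₚ b) ^ₚ (ρ[ x , 1̂ ] ∸ 1)
    weight x (y ∷ ys) = (a -ₚ b) ^ₚ (ρ[ x , y ] ∸ 1) *ₚ b *ₚ weight y ys

    Ψ : Poly
    Ψ = sumₚ chains λ xs → ζ̄-along 0̂ xs ·ₚ weight 0̂ xs

    openInterval : List (∃ λ x → 0̂ < x × x < 1̂)
    openInterval = subtypeList (λ x → (0̂ <? x) ×-dec (x <? 1̂)) elements

{-# OPTIONS --safe #-}
module Submission where

-- Let d = a − b and let K be the matrix with entries ζ̄(x,y) d^(ρ(x,y)−1) for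
-- x < y and 0 otherwise. The ab-indices of all intervals are the entries of the
-- matrix F = K + K b K + K b K b K + ⋯, a finite sum because ρ is strictly
-- increasing, and F = K + K b F = K + F b K. Hence X = V + K b X forces
-- X = V + F b V, and both identities are instances of this principle:
--
--  * For P × B₁ the matrix K becomes [[K, 1 + K d], [0, K]], so the upper right
--    block U of F satisfies U = (1 + K d)(1 + b F) + K b U. Therefore
--    U = (1 + F a)(1 + b F), whose (0̂,1̂) entry is the first formula.
--  * G is a derivation with G(d) = b d − d b, so G(K) = b K − K b. Applying G to
--    F = K + K b F and solving for G(F) gives G(F) + F b = b F + F a b F.

open import Defs
open import Level using (Level; _⊔_)
open import Algebra.Bundles using (CommutativeRing; Ring)
open import Data.Bool.Base using (Bool; true; false; if_then_else_; f≤t)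
open import Data.List.Base using (List; []; _∷_; [_]; _++_; _∷ʳ_; map; concatMap; cartesianProductWith; filter; foldr; upTo; deduplicate)
open import Data.List.Properties using (++-assoc; ++-identityʳ; upTo-∷ʳ; map-upTo)
open import Data.List.Membership.Propositional using () renaming (_∈_ to _∈ₗ_)
open import Data.List.Membership.Propositional.Properties using (∈-deduplicate⁺; ∈-map⁺; ∈-++⁺ˡ; ∈-++⁺ʳ)
import Data.List.Membership.Setoid as Membership
open import Data.List.Relation.Unary.All as All using (All; []; _∷_)
open import Data.List.Relation.Unary.All.Properties using (All¬⇒¬Any)
open import Data.List.Relation.Unary.AllPairs using ([]; _∷_)
open import Data.List.Relation.Unary.Any using (here; there)
open import Data.List.Relation.Unary.Enumerates.Setoid using (IsEnumeration)
open import Data.List.Relation.Unary.Linked using (linked?)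
import Data.List.Relation.Unary.Unique.Setoid as Uniqueness
open import Data.List.Relation.Unary.Unique.DecPropositional.Properties using (deduplicate-!)
open import Data.Nat.Base as ℕ using (ℕ; zero; suc; _∸_)
import Data.Nat.Properties as ℕ
open import Data.Product.Base using (_×_; _,_; ∃; proj₁; proj₂)
open import Function.Base using (_∘_)
open import Function.Bundles using (mk⇔)
open import Relation.Binary.Bundles using (DecSetoid)
open import Relation.Binary.PropositionalEquality as ≡ using (_≡_)
open import Relation.Binary.PropositionalEquality.Properties using (decSetoid)
open import Relation.Nullary using (¬_; Dec; yes; no; does; contradiction)
open import Relation.Nullary.Decidable using (dec-true; dec-false; does-⇔)
open import Relation.Unary using (Pred; Decidable)
import Algebra.Properties.CommutativeSemigroup as CommutativeSemigroupProperties
import Algebra.Properties.Ring as RingProperties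
import Relation.Binary.Construct.NonStrictToStrict as Strict
import Relation.Binary.Reasoning.Setoid as SetoidReasoning

-- `G` is not an inner derivation. Put D = G - [b, · ]. Then D(d) = 0 and D(b) = ab, so D replaces
-- one b at a time in F by ab, and cutting every chain at that b gives D(F) = F ab F. This is where
-- the interior sum comes from. Adding F(a + b) to G(F) = b F - F b + F ab F leaves b F + F a + F ab
-- F, which is (1 + F a)(1 + b F) - 1; hence the two formulas agree. The computation itself goes
-- through the resolvent equations and avoids subtraction.
--
-- One matrix for all pairs is used because a chain sum can be split only when both ends may vary.
-- The price is that Ψ of an interval, a poset with its own carrier and its own shifted rank, has to
-- be identified with an entry of the matrix of P.
--
-- A polynomial is a list of monomials, equal to another when all collected coefficients agree. The
-- ring laws and the properties of `G` are therefore mostly proved by testing against arbitrary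
-- functions on words.

private
  variable
    i j p : Level
    I : Set i
    J : Set j

-- Finite sums in a ring.

module ListSum {a ℓ} (A : Ring a ℓ) where
  open Ring A
  open SetoidReasoning setoid
  open CommutativeSemigroupProperties +-commutativeSemigroup using (interchange)

  ∑ : List I → (I → Carrier) → Carrier
  ∑ is f = foldr (λ i s → f i + s) 0# is

  ∑-cong : ∀ (is : List I) {f g : I → Carrier} → (∀ i → f i ≈ g i) → ∑ is f ≈ ∑ is g
  ∑-cong []       f≈g = refl
  ∑-cong (i ∷ is) f≈g = +-cong (f≈g i) (∑-cong is f≈g)

  ∑-zero : ∀ (is : List I) {f : I → Carrier} → (∀ i → f i ≈ 0#) → ∑ is f ≈ 0#
  ∑-zero []       f≈0 = refl
  ∑-zero (i ∷ is) f≈0 = trans (+-cong (f≈0 i) (∑-zero is f≈0)) (+-identityˡ 0#)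

  ∑-++ : ∀ (is js : List I) {f : I → Carrier} → ∑ (is ++ js) f ≈ ∑ is f + ∑ js f
  ∑-++ []       js = sym (+-identityˡ _)
  ∑-++ (i ∷ is) js = trans (+-congˡ (∑-++ is js)) (sym (+-assoc _ _ _))

  ∑-distrib-+ : ∀ (is : List I) {f g : I → Carrier} → ∑ is (λ i → f i + g i) ≈ ∑ is f + ∑ is g
  ∑-distrib-+ []       = sym (+-identityˡ 0#)
  ∑-distrib-+ (i ∷ is) = trans (+-congˡ (∑-distrib-+ is)) (interchange _ _ _ _)

  *-distribˡ-∑ : ∀ x (is : List I) {f : I → Carrier} → x * ∑ is f ≈ ∑ is (λ i → x * f i)
  *-distribˡ-∑ x []       = zeroʳ x
  *-distribˡ-∑ x (i ∷ is) = trans (distribˡ x _ _) (+-congˡ (*-distribˡ-∑ x is))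

  *-distribʳ-∑ : ∀ x (is : List I) {f : I → Carrier} → ∑ is f * x ≈ ∑ is (λ i → f i * x)
  *-distribʳ-∑ x []       = zeroˡ x
  *-distribʳ-∑ x (i ∷ is) = trans (distribʳ x _ _) (+-congˡ (*-distribʳ-∑ x is))

  ∑-swap : ∀ (is : List I) (js : List J) {f : I → J → Carrier} →
           ∑ is (λ i → ∑ js (f i)) ≈ ∑ js (λ j → ∑ is (λ i → f i j))
  ∑-swap []       js = sym (∑-zero js λ _ → refl)
  ∑-swap (i ∷ is) js = trans (+-congˡ (∑-swap is js)) (sym (∑-distrib-+ js))

  ∑-map : ∀ (h : I → J) is {f : J → Carrier} → ∑ (map h is) f ≡ ∑ is (f ∘ h)
  ∑-map h []           = ≡.refl
  ∑-map h (i ∷ is) {f} = ≡.cong (f (h i) +_) (∑-map h is)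

  ∑-cartesianProductWith : ∀ {k} {K : Set k} (h : I → J → K) is js {f : K → Carrier} →
    ∑ (cartesianProductWith h is js) f ≈ ∑ is (λ i → ∑ js (λ j → f (h i j)))
  ∑-cartesianProductWith h []       js = refl
  ∑-cartesianProductWith h (i ∷ is) js = trans (∑-++ (map (h i) js) _)
    (+-cong (reflexive (∑-map (h i) js)) (∑-cartesianProductWith h is js))

  ∑-concatMap : ∀ (h : I → List J) is {f : J → Carrier} →
                ∑ (concatMap h is) f ≈ ∑ is (λ i → ∑ (h i) f)
  ∑-concatMap h []       = refl
  ∑-concatMap h (i ∷ is) = trans (∑-++ (h i) _) (+-congˡ (∑-concatMap h is))

  ∑-filter : ∀ {P : Pred I p} (P? : Decidable P) is {f : I → Carrier} →
             ∑ (filter P? is) f ≈ ∑ is (λ i → if does (P? i) then f i else 0#)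
  ∑-filter P? [] = refl
  ∑-filter P? (i ∷ is) with does (P? i)
  ... | true  = +-congˡ (∑-filter P? is)
  ... | false = trans (∑-filter P? is) (sym (+-identityˡ _))

  -- The summand `f` may depend on the membership proof, as Ψ of an interval does. Comparing it with
  -- a proof-free `g` that vanishes off `P` turns sums over intervals into sums over the whole
  -- poset.
  ∑-subtypeList : ∀ {P : Pred I p} (P? : Decidable P) is {f : ∃ P → Carrier} {g : I → Carrier} →
    (∀ i (pi : P i) → f (i , pi) ≈ g i) → (∀ i → ¬ P i → g i ≈ 0#) →
    ∑ (subtypeList P? is) f ≈ ∑ is g
  ∑-subtypeList P? []       f≈g g≈0 = refl
  ∑-subtypeList P? (i ∷ is) f≈g g≈0 with P? i
  ... | yes pi = +-cong (f≈g i pi) (∑-subtypeList P? is f≈g g≈0)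
  ... | no ¬pi = trans (∑-subtypeList P? is f≈g g≈0)
                       (sym (trans (+-congʳ (g≈0 i ¬pi)) (+-identityˡ _)))

  ∑-upTo-sucˡ : ∀ n {f : ℕ → Carrier} → ∑ (upTo (suc n)) f ≈ f 0 + ∑ (upTo n) (f ∘ suc)
  ∑-upTo-sucˡ n {f} = +-congˡ (reflexive
    (≡.trans (≡.cong (λ ns → ∑ ns f) (≡.sym (map-upTo suc n))) (∑-map suc (upTo n))))

  ∑-upTo-sucʳ : ∀ n {f : ℕ → Carrier} → ∑ (upTo (suc n)) f ≈ ∑ (upTo n) f + f n
  ∑-upTo-sucʳ n {f} = begin
    ∑ (upTo (suc n)) f       ≡⟨ ≡.cong (λ ns → ∑ ns f) (upTo-∷ʳ n) ⟨
    ∑ (upTo n ∷ʳ n) f        ≈⟨ ∑-++ (upTo n) [ n ] ⟩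
    ∑ (upTo n) f + (f n + 0#) ≈⟨ +-congˡ (+-identityʳ (f n)) ⟩
    ∑ (upTo n) f + f n       ∎

  ∑-upTo-truncate : ∀ {m n} {f : ℕ → Carrier} → m ℕ.≤ n → (∀ k → m ℕ.≤ k → f k ≈ 0#) →
                    ∑ (upTo n) f ≈ ∑ (upTo m) f
  ∑-upTo-truncate {m} {f = f} m≤n f≈0 = go (ℕ.≤⇒≤′ m≤n)
    where
    go : ∀ {n} → m ℕ.≤′ n → ∑ (upTo n) f ≈ ∑ (upTo m) f
    go ℕ.≤′-refl             = refl
    go (ℕ.≤′-step {n} m≤′n) = begin
      ∑ (upTo (suc n)) f  ≈⟨ ∑-upTo-sucʳ n ⟩
      ∑ (upTo n) f + f n  ≈⟨ +-cong (go m≤′n) (f≈0 n (ℕ.≤′⇒≤ m≤′n)) ⟩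
      ∑ (upTo m) f + 0#   ≈⟨ +-identityʳ _ ⟩
      ∑ (upTo m) f        ∎

  module _ {c ℓ′} (S : DecSetoid c ℓ′) where
    private module S = DecSetoid S
    open Membership S.setoid using (_∈_)
    open Uniqueness S.setoid using (Unique)

    private
      kronecker : S.Carrier → (S.Carrier → Carrier) → S.Carrier → Carrier
      kronecker x f y = if does (x S.≟ y) then f y else 0#

      absent : ∀ {x f ys} → All (λ y → ¬ x S.≈ y) ys → ∑ ys (kronecker x f) ≈ 0#
      absent []                       = refl
      absent {x} {f} {y ∷ _} (x≉y ∷ r)
        rewrite dec-false (x S.≟ y) x≉y = trans (+-identityˡ _) (absent r)

    -- Membership supplies one surviving term and uniqueness excludes a second.
    ∑-kronecker : ∀ {x xs} {f : S.Carrier → Carrier} → (∀ {y} → x S.≈ y → f y ≈ f x) →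
      x ∈ xs → Unique xs → ∑ xs (λ y → if does (x S.≟ y) then f y else 0#) ≈ f x
    ∑-kronecker {x} {y ∷ ys} resp (here x≈y) (y≉ys ∷ _)
      rewrite dec-true (x S.≟ y) x≈y =
        trans (+-cong (resp x≈y) (absent (All.map (λ y≉z x≈z → y≉z (S.trans (S.sym x≈y) x≈z)) y≉ys)))
              (+-identityʳ _)
    ∑-kronecker {x} {y ∷ ys} {f} resp (there x∈ys) (y≉ys ∷ uniq) with x S.≟ y
    ... | no  _   = trans (+-identityˡ _) (∑-kronecker resp x∈ys uniq)
    ... | yes x≈y = contradiction x∈ys (All¬⇒¬Any (All.map (λ y≉z x≈z → y≉z (S.trans (S.sym x≈y) x≈z)) y≉ys))

-- Identities in an arbitrary non-commutative ring.

module RingIdentities {a ℓ} (A : Ring a ℓ) where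
  open Ring A
  open RingProperties A
  open SetoidReasoning setoid
  open CommutativeSemigroupProperties +-commutativeSemigroup using (interchange; xy∙z≈xz∙y)

  -- The induction step of the Leibniz rule on words, with `x` as the first letter. The values of
  -- the derivation are free ring elements, so only distributivity and associativity enter.
  leibniz-assoc : ∀ δx x u v δu δv →
    δx * (u * v) + x * (δu * v + u * δv) ≈ (δx * u + x * δu) * v + (x * u) * δv
  leibniz-assoc δx x u v δu δv = begin
    δx * (u * v) + x * (δu * v + u * δv)                ≈⟨ +-congˡ (distribˡ x _ _) ⟩
    δx * (u * v) + (x * (δu * v) + x * (u * δv))        ≈⟨ +-assoc _ _ _ ⟨
    (δx * (u * v) + x * (δu * v)) + x * (u * δv)        ≈⟨ +-cong (+-cong (*-assoc δx u v) (*-assoc x δu v)) (*-assoc x u δv) ⟨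
    ((δx * u) * v + (x * δu) * v) + (x * u) * δv        ≈⟨ +-congʳ (distribʳ v _ _) ⟨
    (δx * u + x * δu) * v + (x * u) * δv                ∎

  -- For x = a and y = b the first bracket is G(a) - G(b), so this is G(d) = b d - d b with d b
  -- moved to the left.
  commutator : ∀ x y → (y * x - x * y) + (x - y) * y ≈ y * (x - y)
  commutator x y = begin
    (y * x - x * y) + (x - y) * y         ≈⟨ +-congˡ ([y-z]x≈yx-zx y x y) ⟩
    (y * x - x * y) + (x * y - y * y)     ≈⟨ +-assoc _ _ _ ⟩
    y * x + (- (x * y) + (x * y - y * y)) ≈⟨ +-congˡ (+-assoc _ _ _) ⟨
    y * x + ((- (x * y) + x * y) - y * y) ≈⟨ +-congˡ (trans (+-congʳ (-‿inverseˡ _)) (+-identityˡ _)) ⟩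
    y * x - y * y                         ≈⟨ x[y-z]≈xy-xz y x y ⟨
    y * (x - y)                           ∎

  module Resolvent {K b F} (F≈K+KbF : F ≈ K + K * b * F) (F≈K+FbK : F ≈ K + F * b * K) where

    -- In effect 1 + F b is a left inverse of 1 − K b.
    resolve : ∀ {X V} → X ≈ V + K * b * X → X ≈ V + F * b * V
    -- Both sides are padded with F b (K b X), so that K + F b K can be collected into F; the
    -- padding is cancelled at the end.
    resolve {X} {V} X≈V+KbX = trans X≈V+KbX (+-congˡ (+-cancelʳ (F * b * (K * b * X)) _ _ (begin
      K * b * X + F * b * (K * b * X)
        ≈⟨ +-congˡ (*-assoc (F * b) (K * b) X) ⟨
      K * b * X + F * b * (K * b) * X
        ≈⟨ +-congˡ (*-congʳ (*-assoc (F * b) K b)) ⟨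
      K * b * X + F * b * K * b * X
        ≈⟨ trans (*-congʳ (distribʳ b K _)) (distribʳ X _ _) ⟨
      (K + F * b * K) * b * X
        ≈⟨ *-congʳ (*-congʳ F≈K+FbK) ⟨
      F * b * X
        ≈⟨ *-congˡ X≈V+KbX ⟩
      F * b * (V + K * b * X)
        ≈⟨ distribˡ (F * b) V _ ⟩
      F * b * V + F * b * (K * b * X)
        ∎)))

    -- `Z` stands for the upper right block of the product's K, and `d + b` for a. The inhomogeneous
    -- term is Z (1 + b F), so `resolve` yields (1 + F b) Z (1 + b F).
    resolve-product : ∀ {d Z U} → Z ≈ 1# + K * d → U ≈ (Z + Z * b * F) + K * b * U →
                      U ≈ (1# + F * (d + b)) + (b * F + F * (d + b) * (b * F))
    resolve-product {d} {Z} {U} Z≈1+Kd U≈ = begin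
      U
        ≈⟨ resolve U≈ ⟩
      (Z + Z * b * F) + F * b * (Z + Z * b * F)
        ≈⟨ factor (+-cong (sym (*-identityʳ Z)) (*-assoc Z b F)) ⟩
      (Z + F * b * Z) * (1# + b * F)
        ≈⟨ *-congʳ Z+FbZ≈1+Fa ⟩
      (1# + F * (d + b)) * (1# + b * F)
        ≈⟨ trans (distribˡ _ 1# _) (+-cong (*-identityʳ _) (trans (distribʳ _ 1# _) (+-congʳ (*-identityˡ _)))) ⟩
      (1# + F * (d + b)) + (b * F + F * (d + b) * (b * F))
        ∎
      where
      factor : ∀ {V} → V ≈ Z * 1# + Z * (b * F) →
               V + F * b * V ≈ (Z + F * b * Z) * (1# + b * F)
      factor {V} V≈ = begin
        V + F * b * V
          ≈⟨ +-cong V≈′ (trans (*-congˡ V≈′) (sym (*-assoc (F * b) Z _))) ⟩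
        Z * (1# + b * F) + F * b * Z * (1# + b * F)
          ≈⟨ distribʳ _ Z _ ⟨
        (Z + F * b * Z) * (1# + b * F)
          ∎
        where V≈′ = trans V≈ (sym (distribˡ Z 1# _))

      -- In (1 + F b)(1 + K d) the terms containing K collect to (K + F b K) d = F d.
      Z+FbZ≈1+Fa : Z + F * b * Z ≈ 1# + F * (d + b)
      Z+FbZ≈1+Fa = begin
        Z + F * b * Z
          ≈⟨ +-cong Z≈1+Kd (*-congˡ Z≈1+Kd) ⟩
        (1# + K * d) + F * b * (1# + K * d)
          ≈⟨ +-congˡ (trans (distribˡ (F * b) 1# _) (+-cong (*-identityʳ _) (sym (*-assoc _ K d)))) ⟩
        (1# + K * d) + (F * b + F * b * K * d)
          ≈⟨ trans (+-assoc 1# _ _) (+-congˡ (trans (+-congˡ (+-comm _ _)) (sym (+-assoc _ _ _)))) ⟩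
        1# + ((K * d + F * b * K * d) + F * b)
          ≈⟨ +-congˡ (+-congʳ (trans (*-congʳ F≈K+FbK) (distribʳ d K _))) ⟨
        1# + (F * d + F * b)
          ≈⟨ +-congˡ (distribˡ F d b) ⟨
        1# + F * (d + b)
          ∎

    -- X = δF + F b + F b b F solves X = (b F + K ab F) + K b X; the summand
    -- F b b F is there to keep the computation free of subtraction.
    resolve-derivation : ∀ {ab δK δF} → δK + K * b ≈ b * K →
      δF ≈ δK + ((δK * b + K * ab) * F + K * b * δF) →
      δF + F * b ≈ b * F + F * ab * F
    resolve-derivation {ab} {δK} {δF} δK+Kb≈bK δF≈ =
      +-cancelʳ (F * b * (b * F)) _ _ (begin
        (δF + F * b) + F * b * (b * F)
          ≈⟨ trans (+-assoc δF _ _) (+-congˡ (sym F*e)) ⟩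
        δF + F * e
          ≈⟨ resolve X≈ ⟩
        (b * F + K * ab * F) + F * b * (b * F + K * ab * F)
          ≈⟨ +-congˡ (distribˡ (F * b) _ _) ⟩
        (b * F + K * ab * F) + (F * b * (b * F) + F * b * (K * ab * F))
          ≈⟨ trans (+-congˡ (+-comm _ _)) (sym (+-assoc _ _ _)) ⟩
        ((b * F + K * ab * F) + F * b * (K * ab * F)) + F * b * (b * F)
          ≈⟨ +-congʳ (+-assoc _ _ _) ⟩
        (b * F + (K * ab * F + F * b * (K * ab * F))) + F * b * (b * F)
          ≈⟨ +-congʳ (+-congˡ KabF+FbKabF≈FabF) ⟩
        (b * F + F * ab * F) + F * b * (b * F)
          ∎)
      where
      -- Chosen so that F e = F b + F b b F, the amount by which X exceeds δF.
      e = b + b * (b * F)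

      F*e : F * e ≈ F * b + F * b * (b * F)
      F*e = trans (distribˡ F b _) (+-congˡ (sym (*-assoc F b _)))

      KabF+FbKabF≈FabF : K * ab * F + F * b * (K * ab * F) ≈ F * ab * F
      KabF+FbKabF≈FabF = begin
        K * ab * F + F * b * (K * ab * F)  ≈⟨ +-congˡ (*-assoc _ _ F) ⟨
        K * ab * F + F * b * (K * ab) * F  ≈⟨ +-congˡ (*-congʳ (*-assoc _ K ab)) ⟨
        K * ab * F + F * b * K * ab * F    ≈⟨ trans (*-congʳ (distribʳ ab K _)) (distribʳ F _ _) ⟨
        (K + F * b * K) * ab * F           ≈⟨ *-congʳ (*-congʳ F≈K+FbK) ⟨
        F * ab * F                         ∎

      -- The terms δK and δK b F of δF pair with K b and K b b F coming from F e. The hypothesis on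
      -- δK absorbs each pair.
      bK+bKbF≈bF : (δK + K * b) + (δK * b * F + K * b * b * F) ≈ b * F
      bK+bKbF≈bF = begin
        (δK + K * b) + (δK * b * F + K * b * b * F)
          ≈⟨ +-congˡ (trans (*-congʳ (distribʳ b δK _)) (distribʳ F _ _)) ⟨
        (δK + K * b) + (δK + K * b) * b * F
          ≈⟨ +-cong δK+Kb≈bK (*-congʳ (*-congʳ δK+Kb≈bK)) ⟩
        b * K + b * K * b * F
          ≈⟨ +-congˡ (trans (*-congʳ (*-assoc b K b)) (*-assoc b _ F)) ⟩
        b * K + b * (K * b * F)
          ≈⟨ distribˡ b K _ ⟨
        b * (K + K * b * F)
          ≈⟨ *-congˡ F≈K+KbF ⟨
        b * F
          ∎

      F*e≈ : F * e ≈ (K * b + K * b * b * F) + K * b * (F * e)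
      F*e≈ = begin
        F * e
          ≈⟨ trans (*-congʳ F≈K+KbF) (distribʳ e K _) ⟩
        K * e + K * b * F * e
          ≈⟨ +-cong (distribˡ K b _) (*-assoc _ F e) ⟩
        (K * b + K * (b * (b * F))) + K * b * (F * e)
          ≈⟨ +-congʳ (+-congˡ (trans (*-assoc _ b F) (*-assoc K b _))) ⟨
        (K * b + K * b * b * F) + K * b * (F * e)
          ∎

      X≈ : δF + F * e ≈ (b * F + K * ab * F) + K * b * (δF + F * e)
      X≈ = begin
        δF + F * e
          ≈⟨ +-cong (trans δF≈ (trans (+-congˡ (+-congʳ (distribʳ F _ _))) (sym (+-assoc _ _ _)))) F*e≈ ⟩
        ((δK + (δK * b * F + K * ab * F)) + K * b * δF) + ((K * b + K * b * b * F) + K * b * (F * e))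
          ≈⟨ interchange _ _ _ _ ⟩
        ((δK + (δK * b * F + K * ab * F)) + (K * b + K * b * b * F)) + (K * b * δF + K * b * (F * e))
          ≈⟨ +-cong (trans (+-congʳ (sym (+-assoc _ _ _))) (xy∙z≈xz∙y _ _ _)) (sym (distribˡ _ _ _)) ⟩
        (((δK + δK * b * F) + (K * b + K * b * b * F)) + K * ab * F) + K * b * (δF + F * e)
          ≈⟨ +-congʳ (+-congʳ (trans (interchange _ _ _ _) bK+bKbF≈bF)) ⟩
        (b * F + K * ab * F) + K * b * (δF + F * e)
          ∎

-- Truncated geometric series.

module Geometric {a ℓ} (A : Ring a ℓ) (K b : Ring.Carrier A) where
  open Ring A
  open ListSum A
  open SetoidReasoning setoid

  term : ℕ → Carrier
  term zero    = K
  term (suc n) = K * b * term n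

  partialSum : ℕ → Carrier
  partialSum n = ∑ (upTo n) term

  term-sucʳ : ∀ n → term (suc n) ≈ term n * b * K
  term-sucʳ zero    = refl
  term-sucʳ (suc n) = begin
    K * b * term (suc n)       ≈⟨ *-congˡ (term-sucʳ n) ⟩
    K * b * (term n * b * K)   ≈⟨ *-assoc _ _ K ⟨
    K * b * (term n * b) * K   ≈⟨ *-congʳ (*-assoc _ (term n) b) ⟨
    K * b * term n * b * K     ∎

  module _ {n} (vanish : term n ≈ 0#) where
    -- Appending the vanishing term of index n costs nothing, and peeling off the term of index 0
    -- instead shifts the sum. So the truncated series satisfies the equation of the infinite one
    -- exactly.
    partialSum-stable : partialSum n ≈ K + ∑ (upTo n) (term ∘ suc)
    partialSum-stable = begin
      partialSum n           ≈⟨ +-identityʳ _ ⟨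
      partialSum n + 0#      ≈⟨ +-congˡ vanish ⟨
      partialSum n + term n  ≈⟨ ∑-upTo-sucʳ n ⟨
      partialSum (suc n)     ≈⟨ ∑-upTo-sucˡ n ⟩
      K + ∑ (upTo n) (term ∘ suc)  ∎

    partialSum-unfoldˡ : partialSum n ≈ K + K * b * partialSum n
    partialSum-unfoldˡ = trans partialSum-stable (+-congˡ (sym (*-distribˡ-∑ _ (upTo n))))

    partialSum-unfoldʳ : partialSum n ≈ K + partialSum n * b * K
    partialSum-unfoldʳ = trans partialSum-stable (+-congˡ (begin
      ∑ (upTo n) (term ∘ suc)               ≈⟨ ∑-cong (upTo n) term-sucʳ ⟩
      ∑ (upTo n) (λ m → term m * b * K)     ≈⟨ *-distribʳ-∑ K (upTo n) ⟨
      ∑ (upTo n) (λ m → term m * b) * K     ≈⟨ *-congʳ (*-distribʳ-∑ b (upTo n)) ⟨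
      partialSum n * b * K                  ∎))

-- The ring of matrices indexed by a finite setoid.

module Matrices {a ℓ c ℓ₁} (A : Ring a ℓ) (S : DecSetoid c ℓ₁)
  (elements : List (DecSetoid.Carrier S)) (enumerates : IsEnumeration (DecSetoid.setoid S) elements)
  (unique : Uniqueness.Unique (DecSetoid.setoid S) elements) where
  open Ring A
  private module S = DecSetoid S
  open ListSum A
  open SetoidReasoning setoid

  -- Entries must respect the equality of indices: in a product with `diag 1#` the surviving index
  -- is only equivalent to the given one.
  record Matrix : Set (a ⊔ ℓ ⊔ c ⊔ ℓ₁) where
    no-eta-equality
    field
      at      : S.Carrier → S.Carrier → Carrier
      at-cong : ∀ {x x′ y y′} → x S.≈ x′ → y S.≈ y′ → at x y ≈ at x′ y′
  open Matrix public

  infix 4 _≈ₘ_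
  record _≈ₘ_ (M N : Matrix) : Set (ℓ ⊔ c) where
    constructor mk≈ₘ
    field
      at-≈ : ∀ x y → at M x y ≈ at N x y
  open _≈ₘ_ public

  -- Scalar matrices put b, d and ab into the same ring as K. They are not central in general, as
  -- `A` need not be commutative.
  diag : Carrier → Matrix
  diag p .at x y = if does (x S.≟ y) then p else 0#
  diag p .at-cong {x} {x′} {y} {y′} x≈x′ y≈y′ =
    reflexive (≡.cong (λ β → if β then p else 0#) (does-⇔ (mk⇔
      (λ x≈y → S.trans (S.sym x≈x′) (S.trans x≈y y≈y′))
      (λ x′≈y′ → S.trans x≈x′ (S.trans x′≈y′ (S.sym y≈y′)))) (x S.≟ y) (x′ S.≟ y′)))

  infixl 6 _+ₘ_
  infixl 7 _*ₘ_
  _+ₘ_ _*ₘ_ : Matrix → Matrix → Matrix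
  (M +ₘ N) .at x y = at M x y + at N x y
  (M +ₘ N) .at-cong x≈ y≈ = +-cong (at-cong M x≈ y≈) (at-cong N x≈ y≈)
  (M *ₘ N) .at x z = ∑ elements λ y → at M x y * at N y z
  (M *ₘ N) .at-cong x≈ z≈ = ∑-cong elements λ y → *-cong (at-cong M x≈ S.refl) (at-cong N S.refl z≈)

  -ₘ_ : Matrix → Matrix
  (-ₘ M) .at x y = - at M x y
  (-ₘ M) .at-cong x≈ y≈ = -‿cong (at-cong M x≈ y≈)

  0ₘ : Matrix
  0ₘ .at _ _ = 0#
  0ₘ .at-cong _ _ = refl

  diag-*ₘ : ∀ p M x z → at (diag p *ₘ M) x z ≈ p * at M x z
  diag-*ₘ p M x z = begin
    ∑ elements (λ y → (if does (x S.≟ y) then p else 0#) * at M y z)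
      ≈⟨ ∑-cong elements (λ y → if-* (does (x S.≟ y))) ⟩
    ∑ elements (λ y → if does (x S.≟ y) then p * at M y z else 0#)
      ≈⟨ ∑-kronecker S (λ x≈y → *-congˡ (at-cong M (S.sym x≈y) S.refl)) (enumerates x) unique ⟩
    p * at M x z
      ∎
    where
    if-* : ∀ β {q} → (if β then p else 0#) * q ≈ (if β then p * q else 0#)
    if-* true  = refl
    if-* false = zeroˡ _

  *ₘ-diag : ∀ M p x z → at (M *ₘ diag p) x z ≈ at M x z * p
  *ₘ-diag M p x z = begin
    ∑ elements (λ y → at M x y * (if does (y S.≟ z) then p else 0#))
      ≈⟨ ∑-cong elements (λ y → *-congˡ (reflexive (≡.cong (λ β → if β then p else 0#)
           (does-⇔ (mk⇔ S.sym S.sym) (y S.≟ z) (z S.≟ y))))) ⟩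
    ∑ elements (λ y → at M x y * (if does (z S.≟ y) then p else 0#))
      ≈⟨ ∑-cong elements (λ y → *-if (does (z S.≟ y))) ⟩
    ∑ elements (λ y → if does (z S.≟ y) then at M x y * p else 0#)
      ≈⟨ ∑-kronecker S (λ z≈y → *-congʳ (at-cong M S.refl (S.sym z≈y))) (enumerates z) unique ⟩
    at M x z * p
      ∎
    where
    *-if : ∀ β {q} → q * (if β then p else 0#) ≈ (if β then q * p else 0#)
    *-if true  = refl
    *-if false = zeroʳ _

  matrixRing : Ring (a ⊔ ℓ ⊔ c ⊔ ℓ₁) (ℓ ⊔ c)
  matrixRing = record
    { Carrier = Matrix
    ; _≈_     = _≈ₘ_
    ; _+_     = _+ₘ_
    ; _*_     = _*ₘ_
    ; -_      = -ₘ_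
    ; 0#      = 0ₘ
    ; 1#      = diag 1#
    ; isRing  = record
      { +-isAbelianGroup = record
        { isGroup = record
          { isMonoid = record
            { isSemigroup = record
              { isMagma = record
                { isEquivalence = record
                  { refl  = mk≈ₘ λ _ _ → refl
                  ; sym   = λ M≈N → mk≈ₘ λ x y → sym (at-≈ M≈N x y)
                  ; trans = λ L≈M M≈N → mk≈ₘ λ x y → trans (at-≈ L≈M x y) (at-≈ M≈N x y)
                  }
                ; ∙-cong = λ L≈M N≈O → mk≈ₘ λ x y → +-cong (at-≈ L≈M x y) (at-≈ N≈O x y)
                }
              ; assoc = λ _ _ _ → mk≈ₘ λ _ _ → +-assoc _ _ _
              }
            ; identity = (λ _ → mk≈ₘ λ _ _ → +-identityˡ _) , (λ _ → mk≈ₘ λ _ _ → +-identityʳ _)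
            }
          ; inverse = (λ _ → mk≈ₘ λ _ _ → -‿inverseˡ _) , (λ _ → mk≈ₘ λ _ _ → -‿inverseʳ _)
          ; ⁻¹-cong = λ M≈N → mk≈ₘ λ x y → -‿cong (at-≈ M≈N x y)
          }
        ; comm = λ _ _ → mk≈ₘ λ _ _ → +-comm _ _
        }
      ; *-cong = λ L≈M N≈O → mk≈ₘ λ x z →
          ∑-cong elements λ y → *-cong (at-≈ L≈M x y) (at-≈ N≈O y z)
      ; *-assoc = λ L M N → mk≈ₘ λ x w → begin
          ∑ elements (λ z → ∑ elements (λ y → at L x y * at M y z) * at N z w)
            ≈⟨ ∑-cong elements (λ z → *-distribʳ-∑ _ elements) ⟩
          ∑ elements (λ z → ∑ elements λ y → (at L x y * at M y z) * at N z w)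
            ≈⟨ ∑-swap elements elements ⟩
          ∑ elements (λ y → ∑ elements λ z → (at L x y * at M y z) * at N z w)
            ≈⟨ ∑-cong elements (λ y → trans (∑-cong elements λ z → *-assoc _ _ _)
                                            (sym (*-distribˡ-∑ _ elements))) ⟩
          ∑ elements (λ y → at L x y * ∑ elements λ z → at M y z * at N z w)
            ∎
      ; *-identity = (λ M → mk≈ₘ λ x y → trans (diag-*ₘ 1# M x y) (*-identityˡ _))
                   , (λ M → mk≈ₘ λ x y → trans (*ₘ-diag M 1# x y) (*-identityʳ _))
      ; distrib = (λ _ _ _ → mk≈ₘ λ _ _ → trans (∑-cong elements λ _ → distribˡ _ _ _) (∑-distrib-+ elements))
                , (λ _ _ _ → mk≈ₘ λ _ _ → trans (∑-cong elements λ _ → distribʳ _ _ _) (∑-distrib-+ elements))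
      }
    }

  diag-+ : ∀ p q → diag p +ₘ diag q ≈ₘ diag (p + q)
  diag-+ p q = mk≈ₘ λ x y → if-+ (does (x S.≟ y))
    where
    if-+ : ∀ β → (if β then p else 0#) + (if β then q else 0#) ≈ (if β then p + q else 0#)
    if-+ true  = refl
    if-+ false = +-identityˡ 0#

  diag-* : ∀ p q → diag p *ₘ diag q ≈ₘ diag (p * q)
  diag-* p q = mk≈ₘ λ x y → trans (diag-*ₘ p (diag q) x y) (*-if (does (x S.≟ y)))
    where
    *-if : ∀ β → p * (if β then q else 0#) ≈ (if β then p * q else 0#)
    *-if true  = refl
    *-if false = zeroʳ p

  diag-cong : ∀ {p q} → p ≈ q → diag p ≈ₘ diag q
  diag-cong p≈q = mk≈ₘ λ x y → if-cong₂ (does (x S.≟ y))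
    where
    if-cong₂ : ∀ β → (if β then _ else 0#) ≈ (if β then _ else 0#)
    if-cong₂ true  = p≈q
    if-cong₂ false = refl

  private module M = ListSum matrixRing

  at-∑ : ∀ (is : List I) (f : I → Matrix) x y → at (M.∑ is f) x y ≡ ∑ is (λ i → at (f i) x y)
  at-∑ []       f x y = ≡.refl
  at-∑ (i ∷ is) f x y = ≡.cong (at (f i) x y +_) (at-∑ is f x y)

-- The ring of ab-polynomials and its derivation `G`.

module Polynomials {r ℓ} (R : CommutativeRing r ℓ) where
  open Over R
  open _≈ₚ_
  private
    module R = CommutativeRing R
    module RP = RingProperties R.ring
    open ListSum R.ring
    open SetoidReasoning R.setoid

  -- The linear extension of k to polynomials, written as an integral because
  -- *ₚ is then the convolution of finitely supported measures on words.
  ∫ : Poly → (Word → R.Carrier) → R.Carrier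
  ∫ f k = ∑ f λ (s , u) → s R.* k u

  ∫-congʳ : ∀ f {k l} → (∀ u → k u R.≈ l u) → ∫ f k R.≈ ∫ f l
  ∫-congʳ f k≈l = ∑-cong f λ (_ , u) → R.*-congˡ (k≈l u)

  ∫-+ₚ : ∀ f g {k} → ∫ (f +ₚ g) k R.≈ ∫ f k R.+ ∫ g k
  ∫-+ₚ f g = ∑-++ f g

  ∫-distrib-+ : ∀ f {k l} → ∫ f (λ u → k u R.+ l u) R.≈ ∫ f k R.+ ∫ f l
  ∫-distrib-+ f = R.trans (∑-cong f λ _ → R.distribˡ _ _ _) (∑-distrib-+ f)

  ∫-·ₚ : ∀ s f {k} → ∫ (s ·ₚ f) k R.≈ s R.* ∫ f k
  ∫-·ₚ s f {k} = begin
    ∫ (s ·ₚ f) k                           ≡⟨ ∑-map _ f ⟩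
    ∑ f (λ (t , u) → (s R.* t) R.* k u)    ≈⟨ ∑-cong f (λ _ → R.*-assoc _ _ _) ⟩
    ∑ f (λ (t , u) → s R.* (t R.* k u))    ≈⟨ *-distribˡ-∑ s f ⟨
    s R.* ∫ f k                            ∎

  ∫-*ₚ : ∀ f g {k} → ∫ (f *ₚ g) k R.≈ ∫ f (λ u → ∫ g (λ v → k (u ++ v)))
  ∫-*ₚ f g {k} = begin
    ∫ (f *ₚ g) k
      ≈⟨ ∑-cartesianProductWith _ f g ⟩
    ∑ f (λ (s , u) → ∑ g λ (t , v) → (s R.* t) R.* k (u ++ v))
      ≈⟨ ∑-cong f (λ (s , u) → R.trans (∑-cong g λ _ → R.*-assoc _ _ _) (R.sym (*-distribˡ-∑ s g))) ⟩
    ∫ f (λ u → ∫ g (λ v → k (u ++ v)))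
      ∎

  ∫-word : ∀ u {k} → ∫ (word u) k R.≈ k u
  ∫-word u = R.trans (R.+-identityʳ _) (R.*-identityˡ _)

  ∫-sumₚ : ∀ (is : List I) {f : I → Poly} {k} → ∫ (sumₚ is f) k R.≈ ∑ is (λ i → ∫ (f i) k)
  ∫-sumₚ []           = R.refl
  ∫-sumₚ (i ∷ is) {f} = R.trans (∫-+ₚ (f i) _) (R.+-congˡ (∫-sumₚ is))

  -- Commutativity of the scalars enters here: the coefficients of `f` and `g` trade places.
  ∫-swap : ∀ f g {k : Word → Word → R.Carrier} →
           ∫ f (λ u → ∫ g (k u)) R.≈ ∫ g (λ v → ∫ f (λ u → k u v))
  ∫-swap f g {k} = begin
    ∫ f (λ u → ∫ g (k u))
      ≈⟨ ∑-cong f (λ (s , _) → *-distribˡ-∑ s g) ⟩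
    ∑ f (λ (s , u) → ∑ g λ (t , v) → s R.* (t R.* k u v))
      ≈⟨ ∑-swap f g ⟩
    ∑ g (λ (t , v) → ∑ f λ (s , u) → s R.* (t R.* k u v))
      ≈⟨ ∑-cong g (λ _ → ∑-cong f λ _ → x∙yz≈y∙xz _ _ _) ⟩
    ∑ g (λ (t , v) → ∑ f λ (s , u) → t R.* (s R.* k u v))
      ≈⟨ ∑-cong g (λ (t , _) → *-distribˡ-∑ t f) ⟨
    ∫ g (λ v → ∫ f (λ u → k u v))
      ∎
    where open CommutativeSemigroupProperties R.*-commutativeSemigroup using (x∙yz≈y∙xz)

  private
    if-*ʳ : ∀ β {s t} → (if β then s else R.0#) R.* t R.≈ (if β then s R.* t else R.0#)
    if-*ʳ true  = R.refl
    if-*ʳ false = R.zeroˡ _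

  coeff-∫ : ∀ f w → coeff f w R.≈ ∫ f (λ u → if does (u ≟ᵂ w) then R.1# else R.0#)
  coeff-∫ []            w = R.refl
  coeff-∫ ((s , u) ∷ f) w = R.+-cong (indicator (does (u ≟ᵂ w))) (coeff-∫ f w)
    where
    indicator : ∀ β → (if β then s else R.0#) R.≈ s R.* (if β then R.1# else R.0#)
    indicator true  = R.sym (R.*-identityʳ s)
    indicator false = R.sym (R.zeroʳ s)

  -- The source of well-definedness: a formal sum, possibly with repeated words, is seen by the
  -- integral only through its collected coefficients.
  ∫-coeff : ∀ {W} → Uniqueness.Unique (≡.setoid Word) W → ∀ f → All (λ (_ , u) → u ∈ₗ W) f →
            ∀ k → ∫ f k R.≈ ∑ W (λ v → coeff f v R.* k v)
  ∫-coeff {W} uniq []            []          k = R.sym (∑-zero W λ _ → R.zeroˡ _)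
  ∫-coeff {W} uniq ((s , u) ∷ f) (u∈W ∷ f⊆W) k = begin
    s R.* k u R.+ ∫ f k
      ≈⟨ R.+-cong (∑-kronecker (decSetoid _≟ᵂ_) (λ { ≡.refl → R.refl }) u∈W uniq)
                  (R.sym (∫-coeff uniq f f⊆W k)) ⟨
    ∑ W (λ v → if does (u ≟ᵂ v) then s R.* k v else R.0#) R.+ ∑ W (λ v → coeff f v R.* k v)
      ≈⟨ R.+-congʳ (∑-cong W λ v → if-*ʳ (does (u ≟ᵂ v))) ⟨
    ∑ W (λ v → (if does (u ≟ᵂ v) then s else R.0#) R.* k v) R.+ ∑ W (λ v → coeff f v R.* k v)
      ≈⟨ ∑-distrib-+ W ⟨
    ∑ W (λ v → (if does (u ≟ᵂ v) then s else R.0#) R.* k v R.+ coeff f v R.* k v)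
      ≈⟨ ∑-cong W (λ v → R.distribʳ (k v) _ _) ⟨
    ∑ W (λ v → coeff ((s , u) ∷ f) v R.* k v)
      ∎

  ∫-congˡ : ∀ {f g} → f ≈ₚ g → ∀ k → ∫ f k R.≈ ∫ g k
  ∫-congˡ {f} {g} f≈g k = begin
    ∫ f k                          ≈⟨ ∫-coeff uniq f (All.tabulate λ x∈f → ∈-deduplicate⁺ _≟ᵂ_ (∈-++⁺ˡ (∈-map⁺ proj₂ x∈f))) k ⟩
    ∑ W (λ v → coeff f v R.* k v)  ≈⟨ ∑-cong W (λ v → R.*-congʳ (coeff-≈ f≈g v)) ⟩
    ∑ W (λ v → coeff g v R.* k v)  ≈⟨ ∫-coeff uniq g (All.tabulate λ x∈g → ∈-deduplicate⁺ _≟ᵂ_ (∈-++⁺ʳ (map proj₂ f) (∈-map⁺ proj₂ x∈g))) k ⟨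
    ∫ g k                          ∎
    where
    -- One list of words serves both polynomials, so that the two sums can be compared term by term.
    W = deduplicate _≟ᵂ_ (map proj₂ f ++ map proj₂ g)
    uniq = deduplicate-! _≟ᵂ_ (map proj₂ f ++ map proj₂ g)

  -- A coefficient is the integral of the indicator function of its word.
  ∫-ext : ∀ {f g} → (∀ k → ∫ f k R.≈ ∫ g k) → f ≈ₚ g
  ∫-ext {f} {g} ∫≈ = mk≈ₚ λ w → R.trans (coeff-∫ f w) (R.trans (∫≈ _) (R.sym (coeff-∫ g w)))

  polyRing : Ring r ℓ
  polyRing = record
    { Carrier = Poly
    ; _≈_     = _≈ₚ_
    ; _+_     = _+ₚ_
    ; _*_     = _*ₚ_
    ; -_      = (R.- R.1#) ·ₚ_
    ; 0#      = 0ₚ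
    ; 1#      = 1ₚ
    ; isRing  = record
      { +-isAbelianGroup = record
        { isGroup = record
          { isMonoid = record
            { isSemigroup = record
              { isMagma = record
                { isEquivalence = record
                  { refl  = mk≈ₚ λ _ → R.refl
                  ; sym   = λ f≈g → mk≈ₚ λ w → R.sym (coeff-≈ f≈g w)
                  ; trans = λ f≈g g≈h → mk≈ₚ λ w → R.trans (coeff-≈ f≈g w) (coeff-≈ g≈h w)
                  }
                ; ∙-cong = λ {f} {f′} {g} {g′} f≈f′ g≈g′ → ∫-ext λ k → begin
                    ∫ (f +ₚ g) k            ≈⟨ ∫-+ₚ f g ⟩
                    ∫ f k R.+ ∫ g k         ≈⟨ R.+-cong (∫-congˡ f≈f′ k) (∫-congˡ g≈g′ k) ⟩
                    ∫ f′ k R.+ ∫ g′ k       ≈⟨ ∫-+ₚ f′ g′ ⟨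
                    ∫ (f′ +ₚ g′) k          ∎
                }
              ; assoc = λ f g h → ∫-ext λ k → R.reflexive (≡.cong (λ e → ∫ e k) (++-assoc f g h))
              }
            ; identity = (λ _ → mk≈ₚ λ _ → R.refl)
                       , (λ f → ∫-ext λ k → R.reflexive (≡.cong (λ e → ∫ e k) (++-identityʳ f)))
            }
          ; inverse = (λ f → ∫-ext λ k → begin
                ∫ ((R.- R.1#) ·ₚ f +ₚ f) k         ≈⟨ ∫-+ₚ ((R.- R.1#) ·ₚ f) f ⟩
                ∫ ((R.- R.1#) ·ₚ f) k R.+ ∫ f k    ≈⟨ R.+-congʳ (∫-neg f k) ⟩
                R.- ∫ f k R.+ ∫ f k                ≈⟨ R.-‿inverseˡ _ ⟩
                R.0#                               ∎)
            , (λ f → ∫-ext λ k → begin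
                ∫ (f -ₚ f) k                       ≈⟨ ∫-+ₚ f ((R.- R.1#) ·ₚ f) ⟩
                ∫ f k R.+ ∫ ((R.- R.1#) ·ₚ f) k    ≈⟨ R.+-congˡ (∫-neg f k) ⟩
                ∫ f k R.- ∫ f k                    ≈⟨ R.-‿inverseʳ _ ⟩
                R.0#                               ∎)
          ; ⁻¹-cong = λ {f} {g} f≈g → ∫-ext λ k → begin
                ∫ ((R.- R.1#) ·ₚ f) k  ≈⟨ ∫-neg f k ⟩
                R.- ∫ f k              ≈⟨ R.-‿cong (∫-congˡ f≈g k) ⟩
                R.- ∫ g k              ≈⟨ ∫-neg g k ⟨
                ∫ ((R.- R.1#) ·ₚ g) k  ∎
          }
        ; comm = λ f g → ∫-ext λ k →
            R.trans (∫-+ₚ f g) (R.trans (R.+-comm _ _) (R.sym (∫-+ₚ g f)))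
        }
      ; *-cong = λ {f} {f′} {g} {g′} f≈f′ g≈g′ → ∫-ext λ k → begin
          ∫ (f *ₚ g) k                            ≈⟨ ∫-*ₚ f g ⟩
          ∫ f (λ u → ∫ g (λ v → k (u ++ v)))      ≈⟨ ∫-congˡ f≈f′ _ ⟩
          ∫ f′ (λ u → ∫ g (λ v → k (u ++ v)))     ≈⟨ ∫-congʳ f′ (λ u → ∫-congˡ g≈g′ _) ⟩
          ∫ f′ (λ u → ∫ g′ (λ v → k (u ++ v)))    ≈⟨ ∫-*ₚ f′ g′ ⟨
          ∫ (f′ *ₚ g′) k                          ∎
      ; *-assoc = λ f g h → ∫-ext λ k → begin
          ∫ (f *ₚ g *ₚ h) k
            ≈⟨ ∫-*ₚ (f *ₚ g) h ⟩
          ∫ (f *ₚ g) (λ u → ∫ h (λ w → k (u ++ w)))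
            ≈⟨ ∫-*ₚ f g ⟩
          ∫ f (λ u → ∫ g (λ v → ∫ h (λ w → k ((u ++ v) ++ w))))
            ≈⟨ ∫-congʳ f (λ u → ∫-congʳ g λ v → ∫-congʳ h λ w → R.reflexive (≡.cong k (++-assoc u v w))) ⟩
          ∫ f (λ u → ∫ g (λ v → ∫ h (λ w → k (u ++ (v ++ w)))))
            ≈⟨ ∫-congʳ f (λ u → ∫-*ₚ g h) ⟨
          ∫ f (λ u → ∫ (g *ₚ h) (λ v → k (u ++ v)))
            ≈⟨ ∫-*ₚ f (g *ₚ h) ⟨
          ∫ (f *ₚ (g *ₚ h)) k
            ∎
      ; *-identity = (λ f → ∫-ext λ k → R.trans (∫-*ₚ 1ₚ f) (∫-word [] {λ u → ∫ f (λ v → k (u ++ v))}))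
                   , (λ f → ∫-ext λ k → R.trans (∫-*ₚ f 1ₚ) (∫-congʳ f λ u →
                       R.trans (∫-word [] {λ v → k (u ++ v)}) (R.reflexive (≡.cong k (++-identityʳ u)))))
      ; distrib = (λ f g h → ∫-ext λ k → begin
            ∫ (f *ₚ (g +ₚ h)) k
              ≈⟨ ∫-*ₚ f (g +ₚ h) ⟩
            ∫ f (λ u → ∫ (g +ₚ h) (λ v → k (u ++ v)))
              ≈⟨ ∫-congʳ f (λ u → ∫-+ₚ g h) ⟩
            ∫ f (λ u → ∫ g (λ v → k (u ++ v)) R.+ ∫ h (λ v → k (u ++ v)))
              ≈⟨ ∫-distrib-+ f ⟩
            ∫ f (λ u → ∫ g (λ v → k (u ++ v))) R.+ ∫ f (λ u → ∫ h (λ v → k (u ++ v)))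
              ≈⟨ R.+-cong (∫-*ₚ f g) (∫-*ₚ f h) ⟨
            ∫ (f *ₚ g) k R.+ ∫ (f *ₚ h) k
              ≈⟨ ∫-+ₚ (f *ₚ g) (f *ₚ h) ⟨
            ∫ (f *ₚ g +ₚ f *ₚ h) k
              ∎)
        , (λ f g h → ∫-ext λ k → begin
            ∫ ((g +ₚ h) *ₚ f) k
              ≈⟨ ∫-*ₚ (g +ₚ h) f ⟩
            ∫ (g +ₚ h) (λ u → ∫ f (λ v → k (u ++ v)))
              ≈⟨ ∫-+ₚ g h ⟩
            ∫ g (λ u → ∫ f (λ v → k (u ++ v))) R.+ ∫ h (λ u → ∫ f (λ v → k (u ++ v)))
              ≈⟨ R.+-cong (∫-*ₚ g f) (∫-*ₚ h f) ⟨
            ∫ (g *ₚ f) k R.+ ∫ (h *ₚ f) k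
              ≈⟨ ∫-+ₚ (g *ₚ f) (h *ₚ f) ⟨
            ∫ (g *ₚ f +ₚ h *ₚ f) k
              ∎)
      }
    }
    where
    ∫-neg : ∀ f k → ∫ ((R.- R.1#) ·ₚ f) k R.≈ R.- ∫ f k
    ∫-neg f k = R.trans (∫-·ₚ (R.- R.1#) f) (RP.-1*x≈-x _)

  open Ring polyRing using (+-cong; +-congˡ; *-congˡ; *-congʳ; *-assoc; *-identityˡ; *-identityʳ)
    renaming (refl to ≈ₚ-refl; sym to ≈ₚ-sym; trans to ≈ₚ-trans)

  ·ₚ-cong : ∀ {s t f g} → s R.≈ t → f ≈ₚ g → s ·ₚ f ≈ₚ t ·ₚ g
  ·ₚ-cong {s} {t} {f} {g} s≈t f≈g = ∫-ext λ k →
    R.trans (∫-·ₚ s f) (R.trans (R.*-cong s≈t (∫-congˡ f≈g k)) (R.sym (∫-·ₚ t g)))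

  ·ₚ-identityˡ : ∀ f → R.1# ·ₚ f ≈ₚ f
  ·ₚ-identityˡ f = ∫-ext λ k → R.trans (∫-·ₚ R.1# f) (R.*-identityˡ _)

  ·ₚ-assoc : ∀ s t f → (s R.* t) ·ₚ f ≈ₚ s ·ₚ t ·ₚ f
  ·ₚ-assoc s t f = ∫-ext λ k → begin
    ∫ ((s R.* t) ·ₚ f) k    ≈⟨ ∫-·ₚ (s R.* t) f ⟩
    (s R.* t) R.* ∫ f k     ≈⟨ R.*-assoc s t _ ⟩
    s R.* (t R.* ∫ f k)     ≈⟨ R.*-congˡ (∫-·ₚ t f) ⟨
    s R.* ∫ (t ·ₚ f) k      ≈⟨ ∫-·ₚ s (t ·ₚ f) ⟨
    ∫ (s ·ₚ t ·ₚ f) k       ∎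

  ·ₚ-distribˡ : ∀ s f g → s ·ₚ (f +ₚ g) ≈ₚ s ·ₚ f +ₚ s ·ₚ g
  ·ₚ-distribˡ s f g = ∫-ext λ k → begin
    ∫ (s ·ₚ (f +ₚ g)) k                   ≈⟨ ∫-·ₚ s (f +ₚ g) ⟩
    s R.* ∫ (f +ₚ g) k                    ≈⟨ R.*-congˡ (∫-+ₚ f g) ⟩
    s R.* (∫ f k R.+ ∫ g k)               ≈⟨ R.distribˡ s _ _ ⟩
    s R.* ∫ f k R.+ s R.* ∫ g k           ≈⟨ R.+-cong (∫-·ₚ s f) (∫-·ₚ s g) ⟨
    ∫ (s ·ₚ f) k R.+ ∫ (s ·ₚ g) k         ≈⟨ ∫-+ₚ (s ·ₚ f) (s ·ₚ g) ⟨
    ∫ (s ·ₚ f +ₚ s ·ₚ g) k                ∎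

  ·ₚ-*ₚ-assoc : ∀ s f g → (s ·ₚ f) *ₚ g ≈ₚ s ·ₚ (f *ₚ g)
  ·ₚ-*ₚ-assoc s f g = ∫-ext λ k → begin
    ∫ ((s ·ₚ f) *ₚ g) k                         ≈⟨ ∫-*ₚ (s ·ₚ f) g ⟩
    ∫ (s ·ₚ f) (λ u → ∫ g (λ v → k (u ++ v)))   ≈⟨ ∫-·ₚ s f ⟩
    s R.* ∫ f (λ u → ∫ g (λ v → k (u ++ v)))    ≈⟨ R.*-congˡ (∫-*ₚ f g) ⟨
    s R.* ∫ (f *ₚ g) k                          ≈⟨ ∫-·ₚ s (f *ₚ g) ⟨
    ∫ (s ·ₚ (f *ₚ g)) k                         ∎

  ·ₚ-*ₚ-comm : ∀ s f g → f *ₚ (s ·ₚ g) ≈ₚ s ·ₚ (f *ₚ g)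
  ·ₚ-*ₚ-comm s f g = ∫-ext λ k → begin
    ∫ (f *ₚ (s ·ₚ g)) k                               ≈⟨ ∫-*ₚ f (s ·ₚ g) ⟩
    ∫ f (λ u → ∫ (s ·ₚ g) (λ v → k (u ++ v)))         ≈⟨ ∫-swap f (s ·ₚ g) ⟩
    ∫ (s ·ₚ g) (λ v → ∫ f (λ u → k (u ++ v)))         ≈⟨ ∫-·ₚ s g ⟩
    s R.* ∫ g (λ v → ∫ f (λ u → k (u ++ v)))          ≈⟨ R.*-congˡ (∫-swap f g) ⟨
    s R.* ∫ f (λ u → ∫ g (λ v → k (u ++ v)))          ≈⟨ R.*-congˡ (∫-*ₚ f g) ⟨
    s R.* ∫ (f *ₚ g) k                                ≈⟨ ∫-·ₚ s (f *ₚ g) ⟨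
    ∫ (s ·ₚ (f *ₚ g)) k                               ∎

  ^ₚ-sucʳ : ∀ f n → f ^ₚ n *ₚ f ≈ₚ f ^ₚ suc n
  ^ₚ-sucʳ f zero    = ≈ₚ-trans (*-identityˡ f) (≈ₚ-sym (*-identityʳ f))
  ^ₚ-sucʳ f (suc n) = ≈ₚ-trans (*-assoc f (f ^ₚ n) f) (*-congˡ {f} (^ₚ-sucʳ f n))

  word-++ : ∀ u v → word (u ++ v) ≈ₚ word u *ₚ word v
  word-++ u v = ∫-ext λ k → R.+-congʳ (R.*-congʳ (R.sym (R.*-identityˡ R.1#)))

  -- Moves `G` from the polynomial to the test function. Congruence, additivity and homogeneity of
  -- `G` are then inherited from the integral.
  ∫-G : ∀ f {k} → ∫ (G f) k R.≈ ∫ f (λ u → ∫ (G-word u) k)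
  ∫-G f = R.trans (∫-sumₚ f) (∑-cong f λ (s , u) → ∫-·ₚ s (G-word u))

  G-cong : ∀ {f g} → f ≈ₚ g → G f ≈ₚ G g
  G-cong {f} {g} f≈g = ∫-ext λ k → R.trans (∫-G f) (R.trans (∫-congˡ f≈g _) (R.sym (∫-G g)))

  G-+ₚ : ∀ f g → G (f +ₚ g) ≈ₚ G f +ₚ G g
  G-+ₚ f g = ∫-ext λ k → begin
    ∫ (G (f +ₚ g)) k                                                 ≈⟨ ∫-G (f +ₚ g) ⟩
    ∫ (f +ₚ g) (λ u → ∫ (G-word u) k)                                ≈⟨ ∫-+ₚ f g ⟩
    ∫ f (λ u → ∫ (G-word u) k) R.+ ∫ g (λ u → ∫ (G-word u) k)        ≈⟨ R.+-cong (∫-G f) (∫-G g) ⟨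
    ∫ (G f) k R.+ ∫ (G g) k                                          ≈⟨ ∫-+ₚ (G f) (G g) ⟨
    ∫ (G f +ₚ G g) k                                                 ∎

  G-·ₚ : ∀ s f → G (s ·ₚ f) ≈ₚ s ·ₚ G f
  G-·ₚ s f = ∫-ext λ k → begin
    ∫ (G (s ·ₚ f)) k                       ≈⟨ ∫-G (s ·ₚ f) ⟩
    ∫ (s ·ₚ f) (λ u → ∫ (G-word u) k)      ≈⟨ ∫-·ₚ s f ⟩
    s R.* ∫ f (λ u → ∫ (G-word u) k)       ≈⟨ R.*-congˡ (∫-G f) ⟨
    s R.* ∫ (G f) k                        ≈⟨ ∫-·ₚ s (G f) ⟨
    ∫ (s ·ₚ G f) k                         ∎

  G-of-word : ∀ u → G (word u) ≈ₚ G-word u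
  G-of-word u = ∫-ext λ k → R.trans (∫-G (word u)) (∫-word u {λ v → ∫ (G-word v) k})

  G-word-++ : ∀ u v → G-word (u ++ v) ≈ₚ G-word u *ₚ word v +ₚ word u *ₚ G-word v
  G-word-++ []      v = ≈ₚ-sym (*-identityˡ (G-word v))
  G-word-++ (x ∷ u) v = ≈ₚ-trans
    (+-cong (*-congˡ {G-letter x} (word-++ u v)) (*-congˡ {word [ x ]} (G-word-++ u v)))
    (≈ₚ-trans (leibniz-assoc (G-letter x) (word [ x ]) (word u) (word v) (G-word u) (G-word v))
              (+-congˡ {G-word (x ∷ u) *ₚ word v} (*-congʳ {G-word v} (≈ₚ-sym (word-++ [ x ] u)))))
    where open RingIdentities polyRing using (leibniz-assoc)

  G-*ₚ : ∀ f g → G (f *ₚ g) ≈ₚ G f *ₚ g +ₚ f *ₚ G g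
  G-*ₚ f g = ∫-ext λ k → begin
    ∫ (G (f *ₚ g)) k
      ≈⟨ ∫-G (f *ₚ g) ⟩
    ∫ (f *ₚ g) (λ u → ∫ (G-word u) k)
      ≈⟨ ∫-*ₚ f g ⟩
    ∫ f (λ u → ∫ g (λ v → ∫ (G-word (u ++ v)) k))
      ≈⟨ ∫-congʳ f (λ u → ∫-congʳ g λ v → leibniz k u v) ⟩
    ∫ f (λ u → ∫ g (λ v → ∫ (G-word u) (λ w → k (w ++ v)) R.+ ∫ (G-word v) (λ w → k (u ++ w))))
      ≈⟨ R.trans (∫-congʳ f λ u → ∫-distrib-+ g) (∫-distrib-+ f) ⟩
    ∫ f (λ u → ∫ g (λ v → ∫ (G-word u) (λ w → k (w ++ v)))) R.+
      ∫ f (λ u → ∫ g (λ v → ∫ (G-word v) (λ w → k (u ++ w))))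
      -- In G f · g the words of `G-word u` precede those of `g`, so the first summand needs its two
      -- inner integrals exchanged.
      ≈⟨ R.+-cong (∫-congʳ f λ u → ∫-swap (G-word u) g) (∫-congʳ f λ u → ∫-G g) ⟨
    ∫ f (λ u → ∫ (G-word u) (λ w → ∫ g (λ v → k (w ++ v)))) R.+ ∫ f (λ u → ∫ (G g) (λ w → k (u ++ w)))
      ≈⟨ R.+-cong (R.trans (∫-*ₚ (G f) g) (∫-G f)) (∫-*ₚ f (G g)) ⟨
    ∫ (G f *ₚ g) k R.+ ∫ (f *ₚ G g) k
      ≈⟨ ∫-+ₚ (G f *ₚ g) (f *ₚ G g) ⟨
    ∫ (G f *ₚ g +ₚ f *ₚ G g) k
      ∎
    where
    leibniz : ∀ k u v → ∫ (G-word (u ++ v)) k R.≈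
              ∫ (G-word u) (λ w → k (w ++ v)) R.+ ∫ (G-word v) (λ w → k (u ++ w))
    leibniz k u v = begin
      ∫ (G-word (u ++ v)) k
        ≈⟨ ∫-congˡ (G-word-++ u v) k ⟩
      ∫ (G-word u *ₚ word v +ₚ word u *ₚ G-word v) k
        ≈⟨ ∫-+ₚ (G-word u *ₚ word v) (word u *ₚ G-word v) ⟩
      ∫ (G-word u *ₚ word v) k R.+ ∫ (word u *ₚ G-word v) k
        ≈⟨ R.+-cong (R.trans (∫-*ₚ (G-word u) (word v)) (∫-congʳ (G-word u) λ w → ∫-word v {λ v → k (w ++ v)}))
                    (R.trans (∫-*ₚ (word u) (G-word v)) (∫-word u {λ u → ∫ (G-word v) (λ w → k (u ++ w))})) ⟩
      ∫ (G-word u) (λ w → k (w ++ v)) R.+ ∫ (G-word v) (λ w → k (u ++ w))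
        ∎

  G-sumₚ : ∀ (is : List I) {f : I → Poly} → G (sumₚ is f) ≈ₚ sumₚ is (G ∘ f)
  G-sumₚ []           = ≈ₚ-refl
  G-sumₚ (i ∷ is) {f} = ≈ₚ-trans (G-+ₚ (f i) (sumₚ is f)) (+-congˡ {G (f i)} (G-sumₚ is))

-- Chain sums as entries of matrix products.

module Chains {r ℓ c ℓ₁ ℓ₂} (R : CommutativeRing r ℓ) (P : Over.QuasiGradedPoset R c ℓ₁ ℓ₂) where
  open Over R
  open Polynomials R
  open QuasiGradedPoset P
  private
    module R = CommutativeRing R
    module A = Ring polyRing
  open ListSum polyRing
  open Matrices polyRing Eq.decSetoid elements enumerates unique public
  open SetoidReasoning A.setoid

  <-trans : ∀ {x y z} → x < y → y < z → x < z
  <-trans = Strict.<-trans _≈_ _≤_ isPartialOrder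

  <-resp-≈ : ∀ {x x′ y y′} → x ≈ x′ → y ≈ y′ → x < y → x′ < y′
  <-resp-≈ x≈x′ y≈y′ (x≤y , x≉y) =
    trans (reflexive (Eq.sym x≈x′)) (trans x≤y (reflexive y≈y′)) ,
    λ x′≈y′ → x≉y (Eq.trans x≈x′ (Eq.trans x′≈y′ (Eq.sym y≈y′)))

  step : Carrier → Carrier → Poly
  step x y = ζ̄ x y ·ₚ (a -ₚ b) ^ₚ (ρ[ x , y ] ∸ 1)

  -- Vanishing off the strict order lets the unrestricted sums in matrix products range over chains
  -- only.
  K : Matrix
  K .at x y = if does (x <? y) then step x y else 0ₚ
  K .at-cong {x} {x′} {y} {y′} x≈x′ y≈y′
    rewrite does-⇔ (mk⇔ (<-resp-≈ x≈x′ y≈y′) (<-resp-≈ (Eq.sym x≈x′) (Eq.sym y≈y′))) (x <? y) (x′ <? y′)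
    with does (x′ <? y′)
  ... | false = A.refl
  ... | true  rewrite ρ-cong x≈x′ | ρ-cong y≈y′ = ·ₚ-cong (ζ̄-cong x≈x′ y≈y′) A.refl

  K-< : ∀ {x y} → x < y → at K x y ≡ step x y
  K-< {x} {y} x<y rewrite dec-true (x <? y) x<y = ≡.refl

  K-≮ : ∀ {x y} → ¬ x < y → at K x y ≡ 0ₚ
  K-≮ {x} {y} x≮y rewrite dec-false (x <? y) x≮y = ≡.refl

  -- In chainsOfLength n, n counts the interior elements of a chain.
  open Geometric matrixRing K (diag b) public renaming (term to chainsOfLength; partialSum to F)

  chainsOfLength-suc : ∀ n x z →
    at (chainsOfLength (suc n)) x z ≈ₚ sumₚ elements (λ y → at K x y *ₚ b *ₚ at (chainsOfLength n) y z)
  chainsOfLength-suc n x z = ∑-cong elements λ y →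
    A.*-congʳ {at (chainsOfLength n) y z} (*ₘ-diag K b x y)

  -- A chain with n interior elements raises ρ by at least n + 1. Guarding the bound by x < z covers
  -- the pairs with x ≮ z too, where it holds vacuously.
  chainsOfLength-zero : ∀ n {x z} → (x < z → ρ z ℕ.≤ ρ x ℕ.+ n) → at (chainsOfLength n) x z ≈ₚ 0ₚ
  chainsOfLength-zero zero {x} {z} ρz≤ = A.reflexive (K-≮ λ x<z →
    ℕ.<⇒≱ (ρ-mono-< x<z) (≡.subst (ρ z ℕ.≤_) (ℕ.+-identityʳ (ρ x)) (ρz≤ x<z)))
  chainsOfLength-zero (suc n) {x} {z} ρz≤ =
    A.trans (chainsOfLength-suc n x z) (∑-zero elements vanish)
    where
    vanish : ∀ y → at K x y *ₚ b *ₚ at (chainsOfLength n) y z ≈ₚ 0ₚ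
    vanish y with x <? y
    ... | no x≮y = A.*-congʳ {at (chainsOfLength n) y z} (A.*-congʳ {b} (A.reflexive (K-≮ x≮y)))
    ... | yes x<y = A.trans (A.*-congˡ {at K x y *ₚ b} (chainsOfLength-zero n λ y<z →
      ℕ.≤-trans (ρz≤ (<-trans x<y y<z))
        (ℕ.≤-trans (ℕ.≤-reflexive (ℕ.+-suc (ρ x) n)) (ℕ.+-monoˡ-≤ n (ρ-mono-< x<y)))))
      (A.zeroʳ (at K x y *ₚ b))

  at-F : ∀ n x z → at (F n) x z ≡ sumₚ (upTo n) (λ m → at (chainsOfLength m) x z)
  at-F n = at-∑ (upTo n) chainsOfLength

  F-≮ : ∀ n {x z} → ¬ x < z → at (F n) x z ≈ₚ 0ₚ
  F-≮ n x≮z = A.trans (A.reflexive (at-F n _ _))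
    (∑-zero (upTo n) λ m → chainsOfLength-zero m λ x<z → contradiction x<z x≮z)

-- The ab-index as a matrix entry.

module BoundedChains {r ℓ c ℓ₁ ℓ₂} (R : CommutativeRing r ℓ) (P : Over.BoundedQuasiGradedPoset R c ℓ₁ ℓ₂) where
  open Over R
  open Polynomials R
  open BoundedQuasiGradedPoset P
  private
    module R = CommutativeRing R
    module A = Ring polyRing
  open ListSum polyRing
  open Chains R quasiGradedPoset public
  open SetoidReasoning A.setoid

  height : ℕ
  height = ρ[ 0̂ , 1̂ ]

  -- Between any two elements ρ rises by at most its rise from 0̂ to 1̂, so one truncation is exact
  -- for all entries at once.
  chainsOfLength-height : chainsOfLength height ≈ₘ 0ₘ
  chainsOfLength-height = mk≈ₘ λ x z → chainsOfLength-zero height {x} {z} λ _ →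
    ℕ.≤-trans (ρ-mono-≤ (maximum z)) (ℕ.≤-trans (ℕ.m≤n+m∸n (ρ 1̂) (ρ 0̂))
      (ℕ.+-monoˡ-≤ height (ρ-mono-≤ (minimum x))))

  -- Moves the chain condition from the filter into the summand, so that the sum over tuples factors
  -- one element at a time.
  chainTerm : Carrier → List Carrier → Poly
  chainTerm x ys = if does (linked? _<?_ (x ∷ ys ++ [ 1̂ ]))
                   then ζ̄-along P x ys ·ₚ weight P x ys else 0ₚ

  chainTerm-[] : ∀ x → chainTerm x [] ≈ₚ at K x 1̂
  chainTerm-[] x with does (x <? 1̂)
  ... | true  = A.refl
  ... | false = A.refl

  chainTerm-∷ : ∀ x y ys → chainTerm x (y ∷ ys) ≈ₚ at K x y *ₚ b *ₚ chainTerm y ys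
  chainTerm-∷ x y ys with does (x <? y)
  ... | false = A.refl
  ... | true with does (linked? _<?_ (y ∷ ys ++ [ 1̂ ]))
  ...   | false = A.sym (A.zeroʳ (step x y *ₚ b))
  ...   | true  = begin
    (ζ̄ x y R.* ζ̄-along P y ys) ·ₚ (d *ₚ b *ₚ w)   ≈⟨ ·ₚ-assoc (ζ̄ x y) (ζ̄-along P y ys) (d *ₚ b *ₚ w) ⟩
    ζ̄ x y ·ₚ ζ̄-along P y ys ·ₚ (d *ₚ b *ₚ w)      ≈⟨ ·ₚ-cong R.refl (·ₚ-*ₚ-comm (ζ̄-along P y ys) (d *ₚ b) w) ⟨
    ζ̄ x y ·ₚ (d *ₚ b *ₚ (ζ̄-along P y ys ·ₚ w))    ≈⟨ ·ₚ-*ₚ-assoc (ζ̄ x y) (d *ₚ b) (ζ̄-along P y ys ·ₚ w) ⟨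
    (ζ̄ x y ·ₚ (d *ₚ b)) *ₚ (ζ̄-along P y ys ·ₚ w)  ≈⟨ A.*-congʳ {ζ̄-along P y ys ·ₚ w} (·ₚ-*ₚ-assoc (ζ̄ x y) d b) ⟨
    step x y *ₚ b *ₚ (ζ̄-along P y ys ·ₚ w)        ∎
    where
    d = (a -ₚ b) ^ₚ (ρ[ x , y ] ∸ 1)
    w = weight P y ys

  -- The start is left free for the induction: a tuple loses its first entry just as the matrix
  -- product loses its first factor, while the end stays 1̂.
  ∑-chainTerm : ∀ n x → sumₚ (tuples P n) (chainTerm x) ≈ₚ at (chainsOfLength n) x 1̂
  ∑-chainTerm zero    x = A.trans (A.+-identityʳ (chainTerm x [])) (chainTerm-[] x)
  ∑-chainTerm (suc n) x = begin
    sumₚ (tuples P (suc n)) (chainTerm x)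
      ≈⟨ ∑-cartesianProductWith _∷_ elements (tuples P n) ⟩
    sumₚ elements (λ y → sumₚ (tuples P n) (λ ys → chainTerm x (y ∷ ys)))
      ≈⟨ ∑-cong elements (λ y → A.trans (∑-cong (tuples P n) (chainTerm-∷ x y))
                                        (A.sym (*-distribˡ-∑ (at K x y *ₚ b) (tuples P n)))) ⟩
    sumₚ elements (λ y → at K x y *ₚ b *ₚ sumₚ (tuples P n) (chainTerm y))
      ≈⟨ ∑-cong elements (λ y → A.*-congˡ {at K x y *ₚ b} (∑-chainTerm n y)) ⟩
    sumₚ elements (λ y → at K x y *ₚ b *ₚ at (chainsOfLength n) y 1̂)
      ≈⟨ chainsOfLength-suc n x 1̂ ⟨
    at (chainsOfLength (suc n)) x 1̂
      ∎

  Ψ≈F : Ψ P ≈ₚ at (F height) 0̂ 1̂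
  Ψ≈F = begin
    Ψ P
      ≈⟨ ∑-filter (λ xs → linked? _<?_ (0̂ ∷ xs ++ [ 1̂ ])) (concatMap (tuples P) (upTo height)) ⟩
    sumₚ (concatMap (tuples P) (upTo height)) (chainTerm 0̂)
      ≈⟨ ∑-concatMap (tuples P) (upTo height) ⟩
    sumₚ (upTo height) (λ n → sumₚ (tuples P n) (chainTerm 0̂))
      ≈⟨ ∑-cong (upTo height) (λ n → ∑-chainTerm n 0̂) ⟩
    sumₚ (upTo height) (λ n → at (chainsOfLength n) 0̂ 1̂)
      ≡⟨ at-F height 0̂ 1̂ ⟨
    at (F height) 0̂ 1̂
      ∎

-- The derivation `G` on powers of a - b.

module PyramidOperator {r ℓ} (R : CommutativeRing r ℓ) where
  open Over R
  open Polynomials R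
  private
    module R = CommutativeRing R
    module A = Ring polyRing
  open SetoidReasoning A.setoid
  open RingIdentities polyRing using (commutator)

  G-letter-word : ∀ x → G (word [ x ]) ≈ₚ G-letter x
  G-letter-word x = begin
    G (word [ x ])                                ≈⟨ G-of-word [ x ] ⟩
    G-letter x *ₚ 1ₚ +ₚ word [ x ] *ₚ 0ₚ          ≈⟨ A.+-cong (A.*-identityʳ (G-letter x)) (A.zeroʳ (word [ x ])) ⟩
    G-letter x +ₚ 0ₚ                              ≈⟨ A.+-identityʳ (G-letter x) ⟩
    G-letter x                                    ∎

  -- G acts on powers of a − b as the inner derivation x ↦ b x − x b.
  G-[a-b]^ : ∀ n → G ((a -ₚ b) ^ₚ n) +ₚ (a -ₚ b) ^ₚ n *ₚ b ≈ₚ b *ₚ (a -ₚ b) ^ₚ n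
  G-[a-b]^ zero = begin
    G 1ₚ +ₚ 1ₚ *ₚ b  ≈⟨ A.+-cong (G-of-word []) (A.*-identityˡ b) ⟩
    b                ≈⟨ A.*-identityʳ b ⟨
    b *ₚ 1ₚ          ∎
  G-[a-b]^ (suc n) = begin
    G (d *ₚ e) +ₚ d *ₚ e *ₚ b
      ≈⟨ A.+-cong (G-*ₚ d e) (A.*-assoc d e b) ⟩
    G d *ₚ e +ₚ d *ₚ G e +ₚ d *ₚ (e *ₚ b)
      ≈⟨ A.+-assoc (G d *ₚ e) (d *ₚ G e) (d *ₚ (e *ₚ b)) ⟩
    G d *ₚ e +ₚ (d *ₚ G e +ₚ d *ₚ (e *ₚ b))
      ≈⟨ A.+-congˡ {G d *ₚ e} (A.distribˡ d (G e) (e *ₚ b)) ⟨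
    G d *ₚ e +ₚ d *ₚ (G e +ₚ e *ₚ b)
      ≈⟨ A.+-congˡ {G d *ₚ e} (A.*-congˡ {d} (G-[a-b]^ n)) ⟩
    G d *ₚ e +ₚ d *ₚ (b *ₚ e)
      ≈⟨ A.+-congˡ {G d *ₚ e} (A.*-assoc d b e) ⟨
    G d *ₚ e +ₚ d *ₚ b *ₚ e
      ≈⟨ A.distribʳ e (G d) (d *ₚ b) ⟨
    (G d +ₚ d *ₚ b) *ₚ e
      ≈⟨ A.*-congʳ {e} G-d ⟩
    b *ₚ d *ₚ e
      ≈⟨ A.*-assoc b d e ⟩
    b *ₚ (d *ₚ e)
      ∎
    where
    d = a -ₚ b
    e = d ^ₚ n

    G-d : G d +ₚ d *ₚ b ≈ₚ b *ₚ d
    G-d = A.trans (A.+-congʳ {d *ₚ b} (A.trans (G-+ₚ a ((R.- R.1#) ·ₚ b))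
      (A.+-cong (G-letter-word 𝐚) (A.trans (G-·ₚ (R.- R.1#) b) (·ₚ-cong R.refl (G-letter-word 𝐛))))))
      (commutator a b)

-- Applying `G` to the chain matrix.

module BoundedChainsDerivation {r ℓ c ℓ₁ ℓ₂} (R : CommutativeRing r ℓ) (P : Over.BoundedQuasiGradedPoset R c ℓ₁ ℓ₂) where
  open Over R
  open Polynomials R
  open PyramidOperator R
  open BoundedQuasiGradedPoset P
  private
    module R = CommutativeRing R
    module A = Ring polyRing
  open ListSum polyRing
  open BoundedChains R P public
  private
    module M = Ring matrixRing

  resolventˡ : F height ≈ₘ K +ₘ K *ₘ diag b *ₘ F height
  resolventˡ = partialSum-unfoldˡ {height} chainsOfLength-height

  resolventʳ : F height ≈ₘ K +ₘ F height *ₘ diag b *ₘ K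
  resolventʳ = partialSum-unfoldʳ {height} chainsOfLength-height

  open RingIdentities.Resolvent matrixRing resolventˡ resolventʳ public

  mapG : Matrix → Matrix
  mapG M .at x y = G (at M x y)
  mapG M .at-cong x≈x′ y≈y′ = G-cong (at-cong M x≈x′ y≈y′)

  mapG-cong : ∀ {M N} → M ≈ₘ N → mapG M ≈ₘ mapG N
  mapG-cong M≈N = mk≈ₘ λ x y → G-cong (at-≈ M≈N x y)

  mapG-+ₘ : ∀ M N → mapG (M +ₘ N) ≈ₘ mapG M +ₘ mapG N
  mapG-+ₘ M N = mk≈ₘ λ x y → G-+ₚ (at M x y) (at N x y)

  mapG-*ₘ : ∀ M N → mapG (M *ₘ N) ≈ₘ mapG M *ₘ N +ₘ M *ₘ mapG N
  mapG-*ₘ M N = mk≈ₘ λ x z → A.trans (G-sumₚ elements)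
    (A.trans (∑-cong elements λ y → G-*ₚ (at M x y) (at N y z)) (∑-distrib-+ elements))

  mapG-diag-b : mapG (diag b) ≈ₘ diag (a *ₚ b)
  mapG-diag-b = mk≈ₘ λ x y → G-if (does (x ≟ y))
    where
    G-if : ∀ β → G (if β then b else 0ₚ) ≈ₚ (if β then a *ₚ b else 0ₚ)
    G-if true  = G-letter-word 𝐛
    G-if false = A.refl

  mapG-K : mapG K +ₘ K *ₘ diag b ≈ₘ diag b *ₘ K
  mapG-K = mk≈ₘ λ x y → begin
    G (at K x y) +ₚ at (K *ₘ diag b) x y  ≈⟨ A.+-congˡ {G (at K x y)} (*ₘ-diag K b x y) ⟩
    G (at K x y) +ₚ at K x y *ₚ b         ≈⟨ entry x y ⟩
    b *ₚ at K x y                         ≈⟨ diag-*ₘ b K x y ⟨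
    at (diag b *ₘ K) x y                  ∎
    where
    open SetoidReasoning A.setoid

    entry : ∀ x y → G (at K x y) +ₚ at K x y *ₚ b ≈ₚ b *ₚ at K x y
    entry x y with does (x <? y)
    ... | false = A.refl
    ... | true  = begin
      G (s ·ₚ e) +ₚ (s ·ₚ e) *ₚ b     ≈⟨ A.+-cong (G-·ₚ s e) (·ₚ-*ₚ-assoc s e b) ⟩
      s ·ₚ G e +ₚ s ·ₚ (e *ₚ b)       ≈⟨ ·ₚ-distribˡ s (G e) (e *ₚ b) ⟨
      s ·ₚ (G e +ₚ e *ₚ b)            ≈⟨ ·ₚ-cong R.refl (G-[a-b]^ (ρ[ x , y ] ∸ 1)) ⟩
      s ·ₚ (b *ₚ e)                   ≈⟨ ·ₚ-*ₚ-comm s b e ⟨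
      b *ₚ (s ·ₚ e)                   ∎
      where
      s = ζ̄ x y
      e = (a -ₚ b) ^ₚ (ρ[ x , y ] ∸ 1)

  mapG-F : mapG (F height) +ₘ F height *ₘ diag b ≈ₘ
           diag b *ₘ F height +ₘ F height *ₘ diag (a *ₚ b) *ₘ F height
  mapG-F = resolve-derivation mapG-K (begin
    mapG (F height)
      ≈⟨ mapG-cong resolventˡ ⟩
    mapG (K +ₘ K *ₘ diag b *ₘ F height)
      ≈⟨ M.trans (mapG-+ₘ K _) (M.+-congˡ (mapG-*ₘ (K *ₘ diag b) (F height))) ⟩
    mapG K +ₘ (mapG (K *ₘ diag b) *ₘ F height +ₘ K *ₘ diag b *ₘ mapG (F height))
      ≈⟨ M.+-congˡ (M.+-congʳ (M.*-congʳ (M.trans (mapG-*ₘ K (diag b)) (M.+-congˡ (M.*-congˡ mapG-diag-b))))) ⟩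
    mapG K +ₘ ((mapG K *ₘ diag b +ₘ K *ₘ diag (a *ₚ b)) *ₘ F height +ₘ K *ₘ diag b *ₘ mapG (F height))
      ∎)
    where open SetoidReasoning M.setoid

  -- The (0̂,1̂) entry of F ab F. The sum runs over all elements, but the ends contribute nothing
  -- because F vanishes on the diagonal.
  interiorSum : Poly
  interiorSum = sumₚ elements λ y → at (F height) 0̂ y *ₚ (a *ₚ b) *ₚ at (F height) y 1̂

  -- Of the two parts of Ψ(P) c, the part Ψ(P) b completes G(Ψ(P)) to the left side of `mapG-F`, and
  -- Ψ(P) a remains.
  Pyr-Ψ : Pyr (Ψ P) ≈ₚ b *ₚ Ψ P +ₚ Ψ P *ₚ a +ₚ interiorSum
  Pyr-Ψ = begin
    Ψ P *ₚ (a +ₚ b) +ₚ G (Ψ P)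
      ≈⟨ A.+-congʳ {G (Ψ P)} (A.distribˡ (Ψ P) a b) ⟩
    (Ψ P *ₚ a +ₚ Ψ P *ₚ b) +ₚ G (Ψ P)
      ≈⟨ A.trans (A.+-assoc (Ψ P *ₚ a) (Ψ P *ₚ b) (G (Ψ P))) (A.+-congˡ {Ψ P *ₚ a} (A.+-comm (Ψ P *ₚ b) (G (Ψ P)))) ⟩
    Ψ P *ₚ a +ₚ (G (Ψ P) +ₚ Ψ P *ₚ b)
      ≈⟨ A.+-congˡ {Ψ P *ₚ a} G-Ψ ⟩
    Ψ P *ₚ a +ₚ (b *ₚ Ψ P +ₚ interiorSum)
      ≈⟨ A.trans (A.+-assoc (b *ₚ Ψ P) (Ψ P *ₚ a) interiorSum) (x∙yz≈y∙xz (b *ₚ Ψ P) (Ψ P *ₚ a) interiorSum) ⟨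
    b *ₚ Ψ P +ₚ Ψ P *ₚ a +ₚ interiorSum
      ∎
    where
    open SetoidReasoning A.setoid
    open CommutativeSemigroupProperties A.+-commutativeSemigroup using (x∙yz≈y∙xz)
    G-Ψ : G (Ψ P) +ₚ Ψ P *ₚ b ≈ₚ b *ₚ Ψ P +ₚ interiorSum
    G-Ψ = begin
      G (Ψ P) +ₚ Ψ P *ₚ b
        ≈⟨ A.+-cong (G-cong Ψ≈F) (A.*-congʳ {b} Ψ≈F) ⟩
      G (at (F height) 0̂ 1̂) +ₚ at (F height) 0̂ 1̂ *ₚ b
        ≈⟨ A.+-congˡ {G (at (F height) 0̂ 1̂)} (*ₘ-diag (F height) b 0̂ 1̂) ⟨
      at (mapG (F height) +ₘ F height *ₘ diag b) 0̂ 1̂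
        ≈⟨ at-≈ mapG-F 0̂ 1̂ ⟩
      at (diag b *ₘ F height) 0̂ 1̂ +ₚ at (F height *ₘ diag (a *ₚ b) *ₘ F height) 0̂ 1̂
        ≈⟨ A.+-cong (diag-*ₘ b (F height) 0̂ 1̂)
             (∑-cong elements λ y → A.*-congʳ {at (F height) y 1̂} (*ₘ-diag (F height) (a *ₚ b) 0̂ y)) ⟩
      b *ₚ at (F height) 0̂ 1̂ +ₚ interiorSum
        ≈⟨ A.+-congʳ {interiorSum} (A.*-congˡ {b} Ψ≈F) ⟨
      b *ₚ Ψ P +ₚ interiorSum
        ∎

-- Comparing intervals with the whole poset.

module Intervals {r ℓ c ℓ₁ ℓ₂} (R : CommutativeRing r ℓ) (P : Over.BoundedQuasiGradedPoset R c ℓ₁ ℓ₂) where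
  open Over R
  open Polynomials R
  open BoundedQuasiGradedPoset P
  private
    module A = Ring polyRing
  open ListSum polyRing
  open BoundedChains R P
  open SetoidReasoning A.setoid

  module _ {x z : Carrier} (x<z : x < z) where
    private
      Ixz = boundedInterval quasiGradedPoset x z x<z
      module I = BoundedQuasiGradedPoset Ixz
      module C = BoundedChains R Ixz

    ρ-interval : ∀ u v → I.ρ[ u , v ] ≡ ρ[ proj₁ u , proj₁ v ]
    ρ-interval (u , x≤u , _) (v , _) = ≡.trans (ℕ.∸-+-assoc (ρ v) (ρ x) (ρ u ∸ ρ x))
      (≡.cong (ρ v ∸_) (ℕ.m+[n∸m]≡n (ρ-mono-≤ x≤u)))

    K-interval : ∀ u v → C.at C.K u v ≡ at K (proj₁ u) (proj₁ v)
    K-interval u v = ≡.cong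
      (λ n → if does (proj₁ u <? proj₁ v) then ζ̄ (proj₁ u) (proj₁ v) ·ₚ (a -ₚ b) ^ₚ (n ∸ 1) else 0ₚ)
      (ρ-interval u v)

    -- Chains between two elements of [x, z] never leave [x, z], so the summands at other elements
    -- of P vanish.
    chainsOfLength-interval : ∀ n u v →
      C.at (C.chainsOfLength n) u v ≈ₚ at (chainsOfLength n) (proj₁ u) (proj₁ v)
    chainsOfLength-interval zero    u v = A.reflexive (K-interval u v)
    chainsOfLength-interval (suc n) u@(u₀ , x≤u , _) v@(v₀ , _ , v≤z) = begin
      C.at (C.chainsOfLength (suc n)) u v
        ≈⟨ C.chainsOfLength-suc n u v ⟩
      sumₚ I.elements (λ y → C.at C.K u y *ₚ b *ₚ C.at (C.chainsOfLength n) y v)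
        ≈⟨ ∑-subtypeList _ elements
             (λ y y∈I → A.*-cong (A.*-congʳ {b} (A.reflexive (K-interval u (y , y∈I))))
                                 (chainsOfLength-interval n (y , y∈I) v))
             outside ⟩
      sumₚ elements (λ y → at K u₀ y *ₚ b *ₚ at (chainsOfLength n) y v₀)
        ≈⟨ chainsOfLength-suc n u₀ v₀ ⟨
      at (chainsOfLength (suc n)) u₀ v₀
        ∎
      where
      outside : ∀ y → ¬ (x ≤ y × y ≤ z) → at K u₀ y *ₚ b *ₚ at (chainsOfLength n) y v₀ ≈ₚ 0ₚ
      outside y y∉I with u₀ <? y
      ... | no u≮y = A.*-congʳ {at (chainsOfLength n) y v₀} (A.*-congʳ {b} (A.reflexive (K-≮ u≮y)))
      ... | yes (u≤y , _) = A.trans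
        (A.*-congˡ {at K u₀ y *ₚ b} (chainsOfLength-zero n λ (y≤v , _) →
          contradiction (trans x≤u u≤y , trans y≤v v≤z) y∉I))
        (A.zeroʳ (at K u₀ y *ₚ b))

    Ψ-interval : Ψ Ixz ≈ₚ at (F height) x z
    Ψ-interval = begin
      Ψ Ixz
        ≈⟨ C.Ψ≈F ⟩
      C.at (C.F C.height) I.0̂ I.1̂
        ≡⟨ ≡.cong (λ n → C.at (C.F n) I.0̂ I.1̂) (ρ-interval I.0̂ I.1̂) ⟩
      C.at (C.F ρ[ x , z ]) I.0̂ I.1̂
        ≡⟨ C.at-F ρ[ x , z ] I.0̂ I.1̂ ⟩
      sumₚ (upTo ρ[ x , z ]) (λ n → C.at (C.chainsOfLength n) I.0̂ I.1̂)
        ≈⟨ ∑-cong (upTo ρ[ x , z ]) (λ n → chainsOfLength-interval n I.0̂ I.1̂) ⟩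
      sumₚ (upTo ρ[ x , z ]) (λ n → at (chainsOfLength n) x z)
        -- The series of the interval stops at ρ[x, z] and that of P at `height`. A chain from x to
        -- z has fewer than ρ[x, z] interior elements, so the surplus terms are zero.
        ≈⟨ ∑-upTo-truncate (ℕ.∸-mono (ρ-mono-≤ (maximum z)) (ρ-mono-≤ (minimum x)))
             (λ n ρ≤n → chainsOfLength-zero n λ _ →
               ℕ.≤-trans (ℕ.m≤n+m∸n (ρ z) (ρ x)) (ℕ.+-monoʳ-≤ (ρ x) ρ≤n)) ⟨
      sumₚ (upTo height) (λ n → at (chainsOfLength n) x z)
        ≡⟨ at-F height x z ⟨
      at (F height) x z
        ∎

  sum-openInterval :
    sumₚ (openInterval P) (λ (x , 0̂<x , x<1̂) →
      Ψ (boundedInterval quasiGradedPoset 0̂ x 0̂<x) *ₚ (a *ₚ b) *ₚ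
      Ψ (boundedInterval quasiGradedPoset x 1̂ x<1̂))
    ≈ₚ sumₚ elements (λ x → at (F height) 0̂ x *ₚ (a *ₚ b) *ₚ at (F height) x 1̂)
  sum-openInterval = ∑-subtypeList _ elements
    (λ x (0̂<x , x<1̂) → A.*-cong (A.*-congʳ {a *ₚ b} (Ψ-interval 0̂<x)) (Ψ-interval x<1̂))
    outside
    where
    outside : ∀ x → ¬ (0̂ < x × x < 1̂) → at (F height) 0̂ x *ₚ (a *ₚ b) *ₚ at (F height) x 1̂ ≈ₚ 0ₚ
    outside x x∉ with 0̂ <? x
    ... | no 0̂≮x = A.*-congʳ {at (F height) x 1̂} (A.*-congʳ {a *ₚ b} (F-≮ height 0̂≮x))
    ... | yes 0̂<x = A.trans
      (A.*-congˡ {at (F height) 0̂ x *ₚ (a *ₚ b)} (F-≮ height λ x<1̂ → x∉ (0̂<x , x<1̂)))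
      (A.zeroʳ (at (F height) 0̂ x *ₚ (a *ₚ b)))

-- The product with B₁ in block form.

-- A matrix indexed by P × B₁ is a 2 × 2 matrix of blocks indexed by P.
module ProductWithB₁ {r ℓ c ℓ₁ ℓ₂} (R : CommutativeRing r ℓ) (P : Over.BoundedQuasiGradedPoset R c ℓ₁ ℓ₂) where
  open Over R
  open Polynomials R
  open BoundedQuasiGradedPoset P
  private
    module R = CommutativeRing R
    module A = Ring polyRing
    module B = BoundedQuasiGradedPoset B₁
    module C = BoundedChainsDerivation R (P ⊗ B₁)
  open ListSum polyRing
  open BoundedChainsDerivation R P
  private
    module M = Ring matrixRing

  block : Bool → Bool → C.Matrix → Matrix
  block i j M .at x y = C.at M (x , i) (y , j)
  block i j M .at-cong x≈x′ y≈y′ = C.at-cong M (x≈x′ , ≡.refl) (y≈y′ , ≡.refl)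

  block-cong : ∀ i j {M N} → M C.≈ₘ N → block i j M ≈ₘ block i j N
  block-cong i j M≈N = mk≈ₘ λ x y → C.at-≈ M≈N (x , i) (y , j)

  block-+ₘ : ∀ i j M N → block i j (M C.+ₘ N) ≈ₘ block i j M +ₘ block i j N
  block-+ₘ i j M N = mk≈ₘ λ _ _ → A.refl

  block-*ₘ : ∀ i k M N → block i k (M C.*ₘ N) ≈ₘ
             block i false M *ₘ block false k N +ₘ block i true M *ₘ block true k N
  block-*ₘ i k M N = mk≈ₘ λ x z → let m = λ y j → C.at M (x , i) (y , j) *ₚ C.at N (y , j) (z , k) in
    A.trans (∑-cartesianProductWith _,_ elements (false ∷ true ∷ []))
      (A.trans (∑-cong elements λ y → A.+-congˡ {m y false} (A.+-identityʳ (m y true)))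
               (∑-distrib-+ elements))

  block-*ₘ-diag : ∀ i j M p → block i j (M C.*ₘ C.diag p) ≈ₘ block i j M *ₘ diag p
  block-*ₘ-diag i j M p = mk≈ₘ λ x y →
    A.trans (C.*ₘ-diag M p (x , i) (y , j)) (A.sym (*ₘ-diag (block i j M) p x y))

  block-K-diagonal : ∀ i → block i i C.K ≈ₘ K
  block-K-diagonal i = mk≈ₘ entry
    where
    entry : ∀ x y → C.at C.K (x , i) (y , i) ≈ₚ at K x y
    entry x y with x <? y
    ... | no x≮y = A.trans (A.reflexive (C.K-≮ λ ((x≤y , _) , ≉) → x≮y (x≤y , λ x≈y → ≉ (x≈y , ≡.refl))))
                           (A.reflexive (≡.sym (K-≮ x≮y)))
    ... | yes x<y@(x≤y , x≉y) = begin
      C.at C.K (x , i) (y , i)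
        ≡⟨ C.K-< ((x≤y , B.refl) , λ (x≈y , _) → x≉y x≈y) ⟩
      (ζ̄ x y R.* B.ζ̄ i i) ·ₚ (a -ₚ b) ^ₚ ((ρ y ℕ.+ B.ρ i) ∸ (ρ x ℕ.+ B.ρ i) ∸ 1)
        ≡⟨ ≡.cong (λ n → (ζ̄ x y R.* B.ζ̄ i i) ·ₚ (a -ₚ b) ^ₚ (n ∸ 1)) shift ⟩
      (ζ̄ x y R.* B.ζ̄ i i) ·ₚ (a -ₚ b) ^ₚ (ρ[ x , y ] ∸ 1)
        ≈⟨ ·ₚ-cong (R.trans (R.*-congˡ (B.ζ̄-diag i)) (R.*-identityʳ _)) A.refl ⟩
      step x y
        ≡⟨ K-< x<y ⟨
      at K x y
        ∎
      where
      open SetoidReasoning A.setoid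
      shift : (ρ y ℕ.+ B.ρ i) ∸ (ρ x ℕ.+ B.ρ i) ≡ ρ[ x , y ]
      shift = ≡.trans (≡.cong₂ _∸_ (ℕ.+-comm (ρ y) (B.ρ i)) (ℕ.+-comm (ρ x) (B.ρ i)))
                      (ℕ.[m+n]∸[m+o]≡n∸o (B.ρ i) (ρ y) (ρ x))

  block-K-lower : block true false C.K ≈ₘ 0ₘ
  block-K-lower = mk≈ₘ λ x y → A.reflexive (C.K-≮ {x , true} {y , false} λ ())

  -- Passing from level 0 to level 1 adds 1 to the rank difference, hence one more factor d than in
  -- K. The new relation (x, 0) < (x, 1) has exponent 0 and gives the identity matrix.
  block-K-upper : block false true C.K ≈ₘ diag 1ₚ +ₘ K *ₘ diag (a -ₚ b)
  block-K-upper = mk≈ₘ λ x y → A.trans (entry x y)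
    (A.+-congˡ {at (diag 1ₚ) x y} (A.sym (*ₘ-diag K d x y)))
    where
    open SetoidReasoning A.setoid
    d = a -ₚ b

    exponent : ∀ x y → (ρ y ℕ.+ 1) ∸ (ρ x ℕ.+ 0) ∸ 1 ≡ ρ[ x , y ]
    exponent x y = ≡.trans (≡.cong₂ (λ m n → m ∸ n ∸ 1) (ℕ.+-comm (ρ y) 1) (ℕ.+-identityʳ (ρ x)))
      (≡.trans (ℕ.∸-+-assoc (suc (ρ y)) (ρ x) 1) (≡.cong (suc (ρ y) ∸_) (ℕ.+-comm (ρ x) 1)))

    upper-step : ∀ {x y} → x ≤ y → C.at C.K (x , false) (y , true) ≈ₚ ζ̄ x y ·ₚ d ^ₚ ρ[ x , y ]
    upper-step {x} {y} x≤y = begin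
      C.at C.K (x , false) (y , true)
        ≡⟨ C.K-< ((x≤y , f≤t) , λ ()) ⟩
      (ζ̄ x y R.* R.1#) ·ₚ d ^ₚ ((ρ y ℕ.+ 1) ∸ (ρ x ℕ.+ 0) ∸ 1)
        ≡⟨ ≡.cong (λ n → (ζ̄ x y R.* R.1#) ·ₚ d ^ₚ n) (exponent x y) ⟩
      (ζ̄ x y R.* R.1#) ·ₚ d ^ₚ ρ[ x , y ]
        ≈⟨ ·ₚ-cong (R.*-identityʳ _) A.refl ⟩
      ζ̄ x y ·ₚ d ^ₚ ρ[ x , y ]
        ∎

    diag-≉ : ∀ {x y} → ¬ x ≈ y → at (diag 1ₚ) x y ≡ 0ₚ
    diag-≉ {x} {y} x≉y = ≡.cong (λ β → if β then 1ₚ else 0ₚ) (dec-false (x ≟ y) x≉y)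

    diag-≈ : ∀ {x y} → x ≈ y → at (diag 1ₚ) x y ≡ 1ₚ
    diag-≈ {x} {y} x≈y = ≡.cong (λ β → if β then 1ₚ else 0ₚ) (dec-true (x ≟ y) x≈y)

    entry : ∀ x y → C.at C.K (x , false) (y , true) ≈ₚ at (diag 1ₚ) x y +ₚ at K x y *ₚ d
    -- The split is by ≤ and ≈ instead of <, because the pairs comparable across the two levels are
    -- exactly those with x ≤ y.
    entry x y = go (x ≤? y) (x ≟ y)
      where
      go : Dec (x ≤ y) → Dec (x ≈ y) → C.at C.K (x , false) (y , true) ≈ₚ at (diag 1ₚ) x y +ₚ at K x y *ₚ d
      go (no x≰y) (yes x≈y) = contradiction (reflexive x≈y) x≰y
      go (no x≰y) (no x≉y) = begin
        C.at C.K (x , false) (y , true)    ≡⟨ C.K-≮ (λ ((x≤y , _) , _) → x≰y x≤y) ⟩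
        0ₚ                                 ≡⟨ ≡.cong₂ (λ f g → f +ₚ g *ₚ d) (diag-≉ x≉y) (K-≮ λ (x≤y , _) → x≰y x≤y) ⟨
        at (diag 1ₚ) x y +ₚ at K x y *ₚ d  ∎
      go (yes x≤y) (yes x≈y) = begin
        C.at C.K (x , false) (y , true)    ≈⟨ upper-step x≤y ⟩
        ζ̄ x y ·ₚ d ^ₚ (ρ y ∸ ρ x)          ≡⟨ ≡.cong (λ n → ζ̄ x y ·ₚ d ^ₚ n) (≡.trans (≡.cong (ρ y ∸_) (ρ-cong x≈y)) (ℕ.n∸n≡0 (ρ y))) ⟩
        ζ̄ x y ·ₚ 1ₚ                        ≈⟨ ·ₚ-cong (R.trans (ζ̄-cong x≈y Eq.refl) (ζ̄-diag y)) A.refl ⟩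
        R.1# ·ₚ 1ₚ                         ≈⟨ ·ₚ-identityˡ 1ₚ ⟩
        1ₚ                                 ≡⟨ ≡.cong₂ (λ f g → f +ₚ g *ₚ d) (diag-≈ x≈y) (K-≮ λ (_ , x≉y) → x≉y x≈y) ⟨
        at (diag 1ₚ) x y +ₚ at K x y *ₚ d  ∎
      go (yes x≤y) (no x≉y) = begin
        C.at C.K (x , false) (y , true)    ≈⟨ upper-step x≤y ⟩
        ζ̄ x y ·ₚ d ^ₚ ρ[ x , y ]           ≡⟨ ≡.cong (λ n → ζ̄ x y ·ₚ d ^ₚ n) (ℕ.m+[n∸m]≡n (ℕ.m<n⇒0<n∸m (ρ-mono-< x<y))) ⟨
        ζ̄ x y ·ₚ d ^ₚ suc n                ≈⟨ ·ₚ-cong R.refl (^ₚ-sucʳ d n) ⟨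
        ζ̄ x y ·ₚ (d ^ₚ n *ₚ d)             ≈⟨ ·ₚ-*ₚ-assoc (ζ̄ x y) (d ^ₚ n) d ⟨
        step x y *ₚ d                      ≡⟨ ≡.cong₂ (λ f g → f +ₚ g *ₚ d) (diag-≉ x≉y) (K-< x<y) ⟨
        at (diag 1ₚ) x y +ₚ at K x y *ₚ d  ∎
        where
        x<y = x≤y , x≉y
        n = ρ[ x , y ] ∸ 1

  private
    Z = block false true C.K
    U = block false true (C.F C.height)
    V = block true true (C.F C.height)

  block-resolvent : ∀ i → block i true (C.F C.height) ≈ₘ block i true C.K +ₘ
    (block i false C.K *ₘ diag b *ₘ U +ₘ block i true C.K *ₘ diag b *ₘ V)
  block-resolvent i = M.trans (block-cong i true C.resolventˡ)
    (M.trans (block-+ₘ i true C.K _) (M.+-congˡ (M.trans (block-*ₘ i true (C.K C.*ₘ C.diag b) (C.F C.height))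
      (M.+-cong (M.*-congʳ (block-*ₘ-diag i false C.K b)) (M.*-congʳ (block-*ₘ-diag i true C.K b))))))

  -- Nothing leads down from the upper level, so V = K + K b V, and `resolve` gives V = K + F b K.
  -- Arguing by the equation avoids matching the two series, which are cut at different heights.
  V≈F : V ≈ₘ F height
  V≈F = M.trans (resolve (begin
    V
      ≈⟨ block-resolvent true ⟩
    block true true C.K +ₘ (block true false C.K *ₘ diag b *ₘ U +ₘ block true true C.K *ₘ diag b *ₘ V)
      ≈⟨ M.+-cong (block-K-diagonal true) (M.+-cong (M.*-congʳ (M.*-congʳ block-K-lower))
                                                    (M.*-congʳ (M.*-congʳ (block-K-diagonal true)))) ⟩
    K +ₘ (0ₘ *ₘ diag b *ₘ U +ₘ K *ₘ diag b *ₘ V)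
      ≈⟨ M.+-congˡ (M.+-congʳ (M.trans (M.*-congʳ (M.zeroˡ (diag b))) (M.zeroˡ U))) ⟩
    K +ₘ (0ₘ +ₘ K *ₘ diag b *ₘ V)
      ≈⟨ M.+-congˡ (M.+-identityˡ _) ⟩
    K +ₘ K *ₘ diag b *ₘ V
      ∎)) (M.sym resolventʳ)
    where open SetoidReasoning M.setoid

  U≈ : U ≈ₘ (diag 1ₚ +ₘ F height *ₘ diag a) +ₘ (diag b *ₘ F height +ₘ F height *ₘ diag (a *ₚ b) *ₘ F height)
  U≈ = begin
    U
      ≈⟨ resolve-product block-K-upper (begin
           U
             ≈⟨ block-resolvent false ⟩
           Z +ₘ (block false false C.K *ₘ diag b *ₘ U +ₘ Z *ₘ diag b *ₘ V)
             ≈⟨ M.+-congˡ (M.+-cong (M.*-congʳ (M.*-congʳ (block-K-diagonal false))) (M.*-congˡ V≈F)) ⟩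
           Z +ₘ (K *ₘ diag b *ₘ U +ₘ Z *ₘ diag b *ₘ F height)
             ≈⟨ M.trans (M.+-congˡ (M.+-comm _ _)) (M.sym (M.+-assoc _ _ _)) ⟩
           (Z +ₘ Z *ₘ diag b *ₘ F height) +ₘ K *ₘ diag b *ₘ U
             ∎) ⟩
    (diag 1ₚ +ₘ F height *ₘ (diag (a -ₚ b) +ₘ diag b)) +ₘ
      (diag b *ₘ F height +ₘ F height *ₘ (diag (a -ₚ b) +ₘ diag b) *ₘ (diag b *ₘ F height))
      ≈⟨ M.+-cong (M.+-congˡ (M.*-congˡ d+b≈a)) (M.+-congˡ (M.*-congʳ (M.*-congˡ d+b≈a))) ⟩
    (diag 1ₚ +ₘ F height *ₘ diag a) +ₘ (diag b *ₘ F height +ₘ F height *ₘ diag a *ₘ (diag b *ₘ F height))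
      ≈⟨ M.+-congˡ (M.+-congˡ (M.trans (M.sym (M.*-assoc _ _ _)) (M.*-congʳ (M.trans (M.*-assoc _ _ _) (M.*-congˡ (diag-* a b)))))) ⟩
    (diag 1ₚ +ₘ F height *ₘ diag a) +ₘ (diag b *ₘ F height +ₘ F height *ₘ diag (a *ₚ b) *ₘ F height)
      ∎
    where
    open SetoidReasoning M.setoid
    d+b≈a : diag (a -ₚ b) +ₘ diag b ≈ₘ diag a
    d+b≈a = M.trans (diag-+ (a -ₚ b) b) (diag-cong (A.trans (A.+-assoc a (A.- b) b)
      (A.trans (A.+-congˡ {a} (A.-‿inverseˡ b)) (A.+-identityʳ a))))

  Ψ-product : Ψ (P ⊗ B₁) ≈ₚ b *ₚ Ψ P +ₚ Ψ P *ₚ a +ₚ interiorSum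
  Ψ-product = begin
    Ψ (P ⊗ B₁)
      ≈⟨ C.Ψ≈F ⟩
    at U 0̂ 1̂
      ≈⟨ at-≈ U≈ 0̂ 1̂ ⟩
    (at (diag 1ₚ) 0̂ 1̂ +ₚ at (F height *ₘ diag a) 0̂ 1̂) +ₚ
      (at (diag b *ₘ F height) 0̂ 1̂ +ₚ at (F height *ₘ diag (a *ₚ b) *ₘ F height) 0̂ 1̂)
      ≈⟨ A.+-cong
           -- The identity matrix contributes nothing at (0̂, 1̂), since 0̂ and 1̂ differ.
           (A.+-cong (A.reflexive (≡.cong (λ β → if β then 1ₚ else 0ₚ) (dec-false (0̂ ≟ 1̂) (proj₂ 0̂<1̂))))
                     (*ₘ-diag (F height) a 0̂ 1̂))
           (A.+-cong (diag-*ₘ b (F height) 0̂ 1̂)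
                     (∑-cong elements λ y → A.*-congʳ {at (F height) y 1̂} (*ₘ-diag (F height) (a *ₚ b) 0̂ y))) ⟩
    at (F height) 0̂ 1̂ *ₚ a +ₚ (b *ₚ at (F height) 0̂ 1̂ +ₚ interiorSum)
      ≈⟨ A.+-cong (A.*-congʳ {a} Ψ≈F) (A.+-congʳ {interiorSum} (A.*-congˡ {b} Ψ≈F)) ⟨
    Ψ P *ₚ a +ₚ (b *ₚ Ψ P +ₚ interiorSum)
      ≈⟨ A.trans (A.+-assoc (b *ₚ Ψ P) (Ψ P *ₚ a) interiorSum) (x∙yz≈y∙xz (b *ₚ Ψ P) (Ψ P *ₚ a) interiorSum) ⟨
    b *ₚ Ψ P +ₚ Ψ P *ₚ a +ₚ interiorSum
      ∎
    where
    open SetoidReasoning A.setoid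
    open CommutativeSemigroupProperties A.+-commutativeSemigroup using (x∙yz≈y∙xz)

proposition5p2 : ∀ {r ℓ c ℓ₁ ℓ₂} (R : CommutativeRing r ℓ) → let open Over R in
    (P : BoundedQuasiGradedPoset c ℓ₁ ℓ₂) → let open BoundedQuasiGradedPoset P in
    (Ψ (P ⊗ B₁) ≈ₚ
       b *ₚ Ψ P +ₚ Ψ P *ₚ a +ₚ
       sumₚ (openInterval P) (λ (x , 0̂<x , x<1̂) →
         Ψ (boundedInterval quasiGradedPoset 0̂ x 0̂<x) *ₚ (a *ₚ b) *ₚ
         Ψ (boundedInterval quasiGradedPoset x 1̂ x<1̂)))
    × (Ψ (P ⊗ B₁) ≈ₚ Pyr (Ψ P))
proposition5p2 R P =
  A.trans Ψ-product (A.+-congˡ {b *ₚ Ψ P +ₚ Ψ P *ₚ a} (A.sym sum-openInterval)) ,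
  A.trans Ψ-product (A.sym Pyr-Ψ)
  where
  open Over R
  module A = Ring (Polynomials.polyRing R)
  open Intervals R P using (sum-openInterval)
  open ProductWithB₁ R P using (Ψ-product)
  open BoundedChainsDerivation R P using (Pyr-Ψ)
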